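{- As formal power series in $q$ (equivalently, for complex $q$ with $0<|q|<1$), $$\sum_{n\ge 0}\frac{q^{n^2+n}}{(q;q)_{2n}}=\frac{1}{(q;q)_\infty}\sum_{k\ge 0}L^*_{2k}(1,-q^{ -1},q)\,q^{k^2+k}=\frac{1}{(q;q)_\infty}\sum_{k\in\mathbb{Z}}\left(q^{15k^2+2k}-q^{15k^2+8k+1}\right).$$
   Context: $(q;q)_n=\prod_{j=1}^{n}(1-q^j)$, $(q;q)_\infty=\prod_{j\ge1}(1-q^j)$, $\begin{bmatrix} n\\ k\end{bmatrix}=\dfrac{(q;q)_n}{(q;q)_k(q;q)_{n-k}}$ for $0\le k\le n$ (and $0$ otherwise), $[n]=\frac{1-q^n}{1-q}$. The classical Lucas polynomials are given by $L_0(x,s)=2$, $L_1(x,s)=x$, $L_n(x,s)=xL_{n-1}(x,s)+sL_{n-2}(x,s)$. Let $D$ be the $q$-differentiation operator $Df(x)=\dfrac{f(x)-f(qx)}{(1-q)x}$. The $q$-Lucas polynomials are $L_n(x,s,q)=L_n\big(x+(q-1)sD,s\big)1$, i.e. the operator obtained by substituting $x+(q-1)sD$ for $x$ (with $x$ acting as multiplication), applied to the constant polynomial $1$. Explicitly, for $n>0$, $$L_n(x,s,q)=\sum_{k=0}^{\lfloor n/2\rfloor} q^{\binom k2}\frac{[n]}{[n-k]}\begin{bmatrix} n-k\\ k\end{bmatrix}s^kx^{n-2k}.$$ Finally $L_n^*(x,s,q)=L_n(x,s,q)$ for $n>0$ and $L_0^*(x,s,q)=1$; $L^*_{2k}(1,-q^{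 -1},q)$ is the value at $x=1$, $s=-q^{ -1}$ (a Laurent polynomial in $q$). -}

module Defs where

open import Algebra.Bundles.Raw using (RawMonoid; RawSemiring)
open import Algebra.Definitions.RawMonoid using (sum)
open import Data.Fin.Base using (toℕ)
open import Data.Integer.Base as ℤ using (ℤ; +_; -[1+_]; 0ℤ; 1ℤ)
open import Data.List.Base as List using (List; []; _∷_)
open import Data.Nat.Base as ℕ using (ℕ; zero; suc; _∸_)
open import Data.Product.Base using (∃-syntax)
open import Data.Vec.Functional as Vector using (Vector)
open import Function.Base using (id; _∘_; _∘′_)
open import Level using (0ℓ)
open import Relation.Binary.PropositionalEquality using (_≡_)

infixl 6 _+ˢ_ _-ˢ_
infixl 7 _*ˢ_
infixl 6 _+_ _-_
infixl 7 _*_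
infix  8 -_ -ˢ_
infix  9 q^-_·_ q^_
infix  4 _≈_ _≈ᵖ_
infix  4 _⟶_ ∑ℕ_≔_ ∑ℤ_≔_
infixl 6 _+ᵖ_ _-ᵖ_
infixl 7 _·ᵖ_

------------------------------------------------------------------------
-- Formal power series in q, as coefficient sequences

ℤ⟦q⟧ : Set
ℤ⟦q⟧ = ℕ → ℤ

0ˢ 1ˢ : ℤ⟦q⟧
0ˢ _ = 0ℤ
1ˢ zero    = 1ℤ
1ˢ (suc _) = 0ℤ

-ˢ_ : ℤ⟦q⟧ → ℤ⟦q⟧
(-ˢ a) n = ℤ.- a n

_+ˢ_ _-ˢ_ _*ˢ_ : ℤ⟦q⟧ → ℤ⟦q⟧ → ℤ⟦q⟧
(a +ˢ b) n = a n ℤ.+ b n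
a -ˢ b     = a +ˢ (-ˢ b)
(a *ˢ b) n = sum ℤ.+-0-rawMonoid {suc n} λ i → a (toℕ i) ℤ.* b (n ∸ toℕ i)

-- raise m a = q^m a.
raise : ℕ → ℤ⟦q⟧ → ℤ⟦q⟧
raise zero    a n       = a n
raise (suc m) a zero    = 0ℤ
raise (suc m) a (suc n) = raise m a n

-- For a with constant coefficient 1, recip a is the multiplicative inverse of
-- a; its coefficients are g₀ = 1 and gₙ₊₁ = - ∑_{i ≤ n} aᵢ₊₁ gₙ₋ᵢ.  It is only
-- meaningful for such a.  recipCoeffs a n is the vector (gₙ , … , g₀).
recipCoeffs : ℤ⟦q⟧ → (n : ℕ) → Vector ℤ (suc n)
recipCoeffs a zero    = 1ℤ Vector.∷ Vector.[]
recipCoeffs a (suc n) =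
  (ℤ.- sum ℤ.+-0-rawMonoid (λ i → a (suc (toℕ i)) ℤ.* recipCoeffs a n i))
  Vector.∷ recipCoeffs a n

recip : ℤ⟦q⟧ → ℤ⟦q⟧
recip a n = Vector.head (recipCoeffs a n)

-- (q;q)ₙ
qPoch : ℕ → ℤ⟦q⟧
qPoch zero    = 1ˢ
qPoch (suc n) = qPoch n *ˢ (1ˢ -ˢ raise (suc n) 1ˢ)

------------------------------------------------------------------------
-- Formal Laurent series in q (finitely many negative powers)

-- q^- m · a stands for q⁻ᵐ a.  Representations are not unique: equality of
-- Laurent series is _≈_, which compares coefficients.
record ℤ⦅q⦆ : Set where
  constructor q^-_·_
  field
    pole   : ℕ
    series : ℤ⟦q⟧

coeff : ℤ⦅q⦆ → ℤ → ℤ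
coeff (q^- m · a) z with z ℤ.+ + m
... | + n      = a n
... | -[1+ _ ] = 0ℤ

_≈_ : ℤ⦅q⦆ → ℤ⦅q⦆ → Set
f ≈ g = ∀ z → coeff f z ≡ coeff g z

ι : ℤ⟦q⟧ → ℤ⦅q⦆
ι a = q^- 0 · a

0# 1# : ℤ⦅q⦆
0# = ι 0ˢ
1# = ι 1ˢ

-_ : ℤ⦅q⦆ → ℤ⦅q⦆
- (q^- m · a) = q^- m · (-ˢ a)

_+_ _-_ _*_ : ℤ⦅q⦆ → ℤ⦅q⦆ → ℤ⦅q⦆
(q^- m · a) + (q^- n · b) = q^- (m ℕ.+ n) · (raise n a +ˢ raise m b)
f - g                     = f + (- g)
(q^- m · a) * (q^- n · b) = q^- (m ℕ.+ n) · (a *ˢ b)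

+-rawMonoid : RawMonoid 0ℓ 0ℓ
+-rawMonoid = record { _≈_ = _≈_ ; _∙_ = _+_ ; ε = 0# }

q^_ : ℤ → ℤ⦅q⦆
q^ (+ n)    = ι (raise n 1ˢ)
q^ -[1+ n ] = q^- suc n · 1ˢ

q : ℤ⦅q⦆
q = q^ 1ℤ

-- f ⟶ l : modulo any power of q, f m eventually agrees with l.
_⟶_ : (ℕ → ℤ⦅q⦆) → ℤ⦅q⦆ → Set
f ⟶ l = ∀ (N : ℤ) → ∃[ M ] ∀ m → M ℕ.≤ m →
        ∀ z → z ℤ.≤ N → coeff (f m) z ≡ coeff l z

-- ∑< n f = f 0 + … + f (n - 1)
∑< : ℕ → (ℕ → ℤ⦅q⦆) → ℤ⦅q⦆
∑< n f = sum +-rawMonoid {n} (f ∘ toℕ)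

∑ℕ_≔_ : (ℕ → ℤ⦅q⦆) → ℤ⦅q⦆ → Set
∑ℕ f ≔ l = (λ n → ∑< n f) ⟶ l

-- The two ends of the partial sums go to infinity independently.
∑ℤ_≔_ : (ℤ → ℤ⦅q⦆) → ℤ⦅q⦆ → Set
∑ℤ f ≔ l = ∀ (N : ℤ) → ∃[ M ] ∀ m n → M ℕ.≤ m → M ℕ.≤ n →
           ∀ z → z ℤ.≤ N →
           coeff (∑< m (λ k → f -[1+ k ]) + ∑< n (λ k → f (+ k))) z ≡ coeff l z

------------------------------------------------------------------------
-- Polynomials in x over ℤ⦅q⦆, as coefficient lists (constant term first)

Poly : Set
Poly = List ℤ⦅q⦆

coeffᵖ : Poly → ℕ → ℤ⦅q⦆
coeffᵖ []      _       = 0#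
coeffᵖ (c ∷ p) zero    = c
coeffᵖ (c ∷ p) (suc n) = coeffᵖ p n

_≈ᵖ_ : Poly → Poly → Set
p ≈ᵖ r = ∀ n → coeffᵖ p n ≈ coeffᵖ r n

1ᵖ : Poly
1ᵖ = 1# ∷ []

_+ᵖ_ _-ᵖ_ : Poly → Poly → Poly
[]      +ᵖ r       = r
(c ∷ p) +ᵖ []      = c ∷ p
(c ∷ p) +ᵖ (d ∷ r) = (c + d) ∷ (p +ᵖ r)
p -ᵖ r             = p +ᵖ List.map -_ r

_·ᵖ_ : ℤ⦅q⦆ → Poly → Poly
c ·ᵖ p = List.map (c *_) p

mulX divX : Poly → Poly
mulX p = 0# ∷ p

-- Division by x of a polynomial without constant term.
divX []      = []
divX (_ ∷ p) = p

eval : Poly → ℤ⦅q⦆ → ℤ⦅q⦆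
eval []      x = 0#
eval (c ∷ p) x = c + x * eval p x

-- dilate c f = f(c x)
dilate : ℤ⦅q⦆ → Poly → Poly
dilate c []      = []
dilate c (a ∷ p) = a ∷ (c ·ᵖ dilate c p)

-- D f = (f(x) - f(qx)) / ((1 - q) x)
D : Poly → Poly
D f = ι (recip (1ˢ -ˢ raise 1 1ˢ)) ·ᵖ divX (f -ᵖ dilate q f)

module _ {c ℓ} (R : RawSemiring c ℓ) where
  private module R = RawSemiring R

  lucas : ℕ → R.Carrier → R.Carrier → R.Carrier
  lucas 0             x s = R.1# R.+ R.1#
  lucas 1             x s = x
  lucas (suc (suc n)) x s = x R.* lucas (suc n) x s R.+ s R.* lucas n x s

-- Operators on polynomials in x, multiplied by composition.
operators : RawSemiring 0ℓ 0ℓ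
operators = record
  { Carrier = Poly → Poly
  ; _≈_     = λ F G → ∀ p → F p ≈ᵖ G p
  ; _+_     = λ F G p → F p +ᵖ G p
  ; _*_     = _∘′_
  ; 0#      = λ _ → []
  ; 1#      = id
  }

-- Lₙ(x, s, q) = Lₙ(x + (q - 1) s D, s) 1 as a polynomial in x.
qLucas : ℕ → ℤ⦅q⦆ → Poly
qLucas n s = lucas operators n (mulX ⊞ (((q - 1#) * s) ·ᵖ_) ∘′ D) (s ·ᵖ_) 1ᵖ
  where
  infixl 6 _⊞_
  _⊞_ = RawSemiring._+_ operators

qLucas* : ℕ → ℤ⦅q⦆ → Poly
qLucas* zero    s = 1ᵖ
qLucas* (suc n) s = qLucas (suc n) s

{-# OPTIONS --safe #-}
module Submission where

-- Write h n = 1/(q;q)ₙ and u = 1/q.  On values at the points qⁱ, the operator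
-- T = x + (q - 1) s D with s = -u satisfies T xⁿ⁺¹ = xⁿ⁺² + u (1 - qⁿ⁺¹) xⁿ.  Let Uₙ
-- be the Fibonacci polynomials of T applied to 1, i.e. Uₙ₊₂ = T Uₙ₊₁ - u Uₙ, so
-- that Lₙ₊₂(x, -u, q) = Uₙ₊₂ - u Uₙ.  Induction with T gives both the inversion
--   h (2n) x²ⁿ = ∑ₖ h (n - k) h (n + k + 1) (1 - q²ᵏ⁺¹) U₂ₖ
-- and, through Carlitz' q-Fibonacci polynomials, f (n + 3) = -qⁿ⁺¹ f n for
-- f n = Uₙ(1).  Put b k = q^(k² + k) (1 - q²ᵏ⁺¹) f (2k).  Multiplying the inversion
-- at x = 1 by q^(n² + n), summing over n, and using Durfee's identity
--   ∑ⱼ q^(j² + j m) h j h (j + m) = 1/(q;q)_∞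
-- with m = 2k + 1 shows that the first sum is ∑ₖ b k / (q;q)_∞.  The terms
-- L*₂ₖ(1, -u, q) q^(k² + k) have sum ∑ₖ b k by telescoping, and the explicit
-- values of f turn b (3m), b (3m + 1), b (3m + 2) into the theta summand at m, 0,
-- and the theta summand at -m-1.

open import Algebra.Bundles using (CommutativeRing)
import Algebra.Properties.CommutativeSemiring.Exp as Exp
import Algebra.Properties.Semiring.Sum as SemiringSum
import Algebra.Solver.Ring as RingSolver
open import Algebra.Solver.Ring.AlmostCommutativeRing using (fromCommutativeRing; _-Raw-AlmostCommutative⟶_)
open import Data.Fin.Base as Fin using (Fin; toℕ)
import Data.Fin.Properties as Fin
open import Data.Integer.Base as ℤ using (ℤ; +_; -[1+_]; 0ℤ; 1ℤ; -1ℤ)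
import Data.Integer.Properties as ℤ
import Data.Integer.Solver as ℤ
open import Data.List.Base using ([]; _∷_; map)
import Data.Maybe.Base as Maybe
open import Data.Nat.Base as ℕ using (ℕ; zero; suc; _∸_; s≤s; z≤n)
import Data.Nat.Properties as ℕ
import Data.Nat.Solver as ℕ
open import Data.Product.Base using (_×_; _,_; ∃-syntax)
open import Data.Sum.Base using (inj₁; inj₂)
open import Function.Base using (_∘_)
open import Level using (0ℓ)
open import Relation.Binary.Bundles using (Setoid)
open import Relation.Binary.PropositionalEquality as ≡ using (_≡_; _≗_)
import Relation.Binary.Reasoning.Setoid as SetoidReasoning
open import Relation.Binary.Structures using (IsEquivalence)
open import Relation.Nullary.Decidable using (dec⇒maybe)

-- Two rings are involved. T needs u = 1/q, hence Laurent series; the infinite sums are handled by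
-- congruences modulo qᴺ between power series. The finite identities are therefore proved over an
-- arbitrary commutative ring and used in both. The bridge is that f n has no pole, being determined
-- by f 0 = f 1 = 1, f 2 = 0 and its recurrence. Infinite double sums are never rearranged: each
-- identity is exact for partial sums, and whatever is left over is divisible by a high power of q.
-- Values at the points qⁱ suffice because D only compares x with qx. In the end only i = 0 matters,
-- but T at i looks at i + 1, so the inductions run over all i. T changes the parity of the degree,
-- so the inversion of even powers is proved together with its odd companion h (2n + 1) x²ⁿ⁺¹ = ∑ₖ h
-- (n - k) h (n + k + 2) (1 - q²ᵏ⁺²) U₂ₖ₊₁.

private ℤ-rawRing = CommutativeRing.rawRing ℤ.+-*-commutativeRing

-- Algebra in an arbitrary commutative ring

-- A ring whose equality is a record type, so that the sides of an equation can
-- be inferred from its type, which is not the case for _≗_ and _≈_.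
record Wrap {A : Set} (_~_ : A → A → Set) (x y : A) : Set where
  constructor wrap
  field unwrap : x ~ y
open Wrap public

wrapRing : CommutativeRing 0ℓ 0ℓ → CommutativeRing 0ℓ 0ℓ
wrapRing R = record
  { Carrier = Carrier ; _≈_ = Wrap _≈_ ; _+_ = _+_ ; _*_ = _*_ ; -_ = -_ ; 0# = 0# ; 1# = 1#
  ; isCommutativeRing = record
    { isRing = record
      { +-isAbelianGroup = record
        { isGroup = record
          { isMonoid = record
            { isSemigroup = record
              { isMagma = record
                { isEquivalence = record
                  { refl  = wrap refl
                  ; sym   = λ d → wrap (sym (unwrap d))
                  ; trans = λ d e → wrap (trans (unwrap d) (unwrap e))
                  }
                ; ∙-cong = λ d e → wrap (+-cong (unwrap d) (unwrap e))
                }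
              ; assoc = λ x y z → wrap (+-assoc x y z)
              }
            ; identity = (λ x → wrap (+-identityˡ x)) , (λ x → wrap (+-identityʳ x))
            }
          ; inverse = (λ x → wrap (-‿inverseˡ x)) , (λ x → wrap (-‿inverseʳ x))
          ; ⁻¹-cong = λ d → wrap (-‿cong (unwrap d))
          }
        ; comm = λ x y → wrap (+-comm x y)
        }
      ; *-cong = λ d e → wrap (*-cong (unwrap d) (unwrap e))
      ; *-assoc = λ x y z → wrap (*-assoc x y z)
      ; *-identity = (λ x → wrap (*-identityˡ x)) , (λ x → wrap (*-identityʳ x))
      ; distrib = (λ x y z → wrap (distribˡ x y z)) , (λ x y z → wrap (distribʳ x y z))
      }
    ; *-comm = λ x y → wrap (*-comm x y)
    }
  }
  where open CommutativeRing R

wrapConstants : ∀ R → ℤ-rawRing -Raw-AlmostCommutative⟶ fromCommutativeRing R →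
  ℤ-rawRing -Raw-AlmostCommutative⟶ fromCommutativeRing (wrapRing R)
wrapConstants R ℤ⟶R = record
  { ⟦_⟧    = ⟦_⟧
  ; +-homo = λ x y → wrap (+-homo x y)
  ; *-homo = λ x y → wrap (*-homo x y)
  ; -‿homo = λ x → wrap (-‿homo x)
  ; 0-homo = wrap 0-homo
  ; 1-homo = wrap 1-homo
  }
  where open _-Raw-AlmostCommutative⟶_ ℤ⟶R

module ℕ-Solver = ℕ.+-*-Solver
open ℕ-Solver using () renaming (con to :con; _:+_ to _⊕_; _:*_ to _⊗_; _:=_ to _≔_)

module Ring (R : CommutativeRing 0ℓ 0ℓ)
            (ℤ⟶R : ℤ-rawRing -Raw-AlmostCommutative⟶ fromCommutativeRing R) where

  open CommutativeRing R public hiding (zero)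
  open import Relation.Binary.Reasoning.Setoid setoid public
  open SemiringSum semiring public
  open Exp commutativeSemiring public

  open RingSolver ℤ-rawRing (fromCommutativeRing R) ℤ⟶R
    (λ x y → Maybe.map (reflexive ∘ ≡.cong (_-Raw-AlmostCommutative⟶_.⟦_⟧ ℤ⟶R)) (dec⇒maybe (x ℤ.≟ y))) public
    using (Polynomial; solve; con; _:=_; _:+_; _:*_; _:-_; :-_; _:^_)

  -- ⟦ 𝟙 ⟧ is definitionally 1#, unlike ⟦ con 1ℤ ⟧.
  𝟙 : ∀ {n} → Polynomial n
  𝟙 = con 0ℤ :^ 0

  ∑ : ℕ → (ℕ → Carrier) → Carrier
  ∑ n f = sum {n} (f ∘ toℕ)

  ∑-cong : ∀ n {f g} → (∀ k → f k ≈ g k) → ∑ n f ≈ ∑ n g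
  ∑-cong n e = sum-cong-≋ {n} (e ∘ toℕ)

  ∑-cong-< : ∀ n {f g} → (∀ k → k ℕ.< n → f k ≈ g k) → ∑ n f ≈ ∑ n g
  ∑-cong-< zero    e = refl
  ∑-cong-< (suc n) e = +-cong (e 0 (s≤s z≤n)) (∑-cong-< n (λ k k<n → e (suc k) (s≤s k<n)))

  ∑-+ : ∀ n f g → ∑ n (λ k → f k + g k) ≈ ∑ n f + ∑ n g
  ∑-+ n f g = ∑-distrib-+ {n} (f ∘ toℕ) (g ∘ toℕ)

  ∑-*ˡ : ∀ n x f → x * ∑ n f ≈ ∑ n (λ k → x * f k)
  ∑-*ˡ n x f = *-distribˡ-sum {n} x (f ∘ toℕ)

  ∑-zero : ∀ n → ∑ n (λ _ → 0#) ≈ 0#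
  ∑-zero n = sum-replicate-zero n

  ∑-last : ∀ n f → ∑ (suc n) f ≈ ∑ n f + f n
  ∑-last zero    f = trans (+-identityʳ _) (sym (+-identityˡ _))
  ∑-last (suc n) f = trans (+-congˡ (∑-last n (f ∘ suc))) (sym (+-assoc _ _ _))

  ∑-split : ∀ m n f → ∑ (m ℕ.+ n) f ≈ ∑ m f + ∑ n (λ k → f (m ℕ.+ k))
  ∑-split zero    n f = sym (+-identityˡ _)
  ∑-split (suc m) n f = trans (+-congˡ (∑-split m n (f ∘ suc))) (sym (+-assoc _ _ _))

  x^n*2≈x^n*x^n : ∀ x n → x ^ (n ℕ.* 2) ≈ x ^ n * x ^ n
  x^n*2≈x^n*x^n x n = begin
    x ^ (n ℕ.* 2)      ≈⟨ ^-assocʳ x n 2 ⟨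
    (x ^ n) ^ 2        ≈⟨ *-congˡ (*-identityʳ (x ^ n)) ⟩
    x ^ n * x ^ n      ∎

  inverse-^ : ∀ {x y} → x * y ≈ 1# → ∀ n → x ^ n * y ^ n ≈ 1#
  inverse-^ {x} {y} xy≈1 zero    = *-identityˡ 1#
  inverse-^ {x} {y} xy≈1 (suc n) = begin
    x * x ^ n * (y * y ^ n)    ≈⟨ solve 4 (λ a b c d → a :* b :* (c :* d) := a :* c :* (b :* d)) refl x (x ^ n) y (y ^ n) ⟩
    x * y * (x ^ n * y ^ n)    ≈⟨ *-cong xy≈1 (inverse-^ xy≈1 n) ⟩
    1# * 1#                    ≈⟨ *-identityˡ 1# ⟩
    1#                         ∎

  -- The ring solver cannot use a relation such as q u = 1. Computations that need one let it prove
  -- an identity with an extra summand `(e - 1#) * k`, for an explicit cofactor `k`, which is then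
  -- discarded here.
  +-0*ʳ : ∀ {e} x k → e ≈ 1# → x + (e - 1#) * k ≈ x
  +-0*ʳ {e} x k e≈1 = begin
    x + (e - 1#) * k     ≈⟨ +-congˡ (*-congʳ (+-congʳ e≈1)) ⟩
    x + (1# - 1#) * k    ≈⟨ solve 2 (λ x k → x :+ (𝟙 :- 𝟙) :* k := x) refl x k ⟩
    x                    ∎

  -- h n plays the role of 1 / (q;q)ₙ.
  module ReciprocalFactorials (q : Carrier) (h : ℕ → Carrier) (h-zero : h 0 ≈ 1#)
                              (h-suc : ∀ n → (1# - q ^ suc n) * h (suc n) ≈ h n) where

    -- Durfee's identity for partial sums

    durfeeTerm : ℕ → ℕ → Carrier
    durfeeTerm m j = q ^ (j ℕ.* j ℕ.+ j ℕ.* m) * (h j * h (j ℕ.+ m))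

    -- Writing `h J` and `h (J + m)` as multiples of `h (suc J)` and `h (suc (J + m))` gives all
    -- four terms the common factor `h₁ * h₂`; a polynomial identity remains. It is the increment in
    -- `J` of `durfee-step`.
    durfeeTerm-difference : ∀ m J →
      durfeeTerm m J + (1# - q ^ suc J) * durfeeTerm m (suc J) ≈ (1# - q ^ J) * durfeeTerm m J + durfeeTerm (suc m) J
    durfeeTerm-difference m J = begin
      e * (h J * h (J ℕ.+ m)) + (1# - q * y) * (q ^ (suc J ℕ.* suc J ℕ.+ suc J ℕ.* m) * (h₁ * h₂))
        ≈⟨ +-cong (*-congˡ (*-cong hJ hJm)) (*-congˡ (*-congʳ e₁)) ⟩
      e * ((1# - q * y) * h₁ * ((1# - q * (y * w)) * h₂)) + (1# - q * y) * (e * (q * (y * (y * w))) * (h₁ * h₂))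
        ≈⟨ solve 6 (λ e q y w h₁ h₂ →
             e :* ((𝟙 :- q :* y) :* h₁ :* ((𝟙 :- q :* (y :* w)) :* h₂)) :+ (𝟙 :- q :* y) :* (e :* (q :* (y :* (y :* w))) :* (h₁ :* h₂))
             := (𝟙 :- y) :* (e :* ((𝟙 :- q :* y) :* h₁ :* ((𝟙 :- q :* (y :* w)) :* h₂))) :+ e :* y :* ((𝟙 :- q :* y) :* h₁ :* h₂))
             refl e q y w h₁ h₂ ⟩
      (1# - y) * (e * ((1# - q * y) * h₁ * ((1# - q * (y * w)) * h₂))) + e * y * ((1# - q * y) * h₁ * h₂)
        ≈⟨ +-cong (*-congˡ (*-congˡ (*-cong hJ hJm))) (*-cong e₂ (*-cong hJ (reflexive (≡.cong h (ℕ.+-suc J m))))) ⟨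
      (1# - y) * (e * (h J * h (J ℕ.+ m))) + q ^ (J ℕ.* J ℕ.+ J ℕ.* suc m) * (h J * h (J ℕ.+ suc m)) ∎
      where
      e = q ^ (J ℕ.* J ℕ.+ J ℕ.* m)
      y = q ^ J
      w = q ^ m
      h₁ = h (suc J)
      h₂ = h (suc (J ℕ.+ m))
      hJ : h J ≈ (1# - q * y) * h₁
      hJ = sym (h-suc J)
      hJm : h (J ℕ.+ m) ≈ (1# - q * (y * w)) * h₂
      hJm = trans (sym (h-suc (J ℕ.+ m))) (*-congʳ (+-congˡ (-‿cong (*-congˡ (^-homo-* q J m)))))
      e₁ : q ^ (suc J ℕ.* suc J ℕ.+ suc J ℕ.* m) ≈ e * (q * (y * (y * w)))
      e₁ = trans (^-congʳ q (ℕ-Solver.solve 2 (λ J m → (:con 1 ⊕ J) ⊗ (:con 1 ⊕ J) ⊕ (:con 1 ⊕ J) ⊗ m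
                                         ≔ (J ⊗ J ⊕ J ⊗ m) ⊕ (:con 1 ⊕ (J ⊕ (J ⊕ m)))) ≡.refl J m))
             (trans (^-homo-* q (J ℕ.* J ℕ.+ J ℕ.* m) _)
                (*-congˡ (*-congˡ (trans (^-homo-* q J (J ℕ.+ m)) (*-congˡ (^-homo-* q J m))))))
      e₂ : q ^ (J ℕ.* J ℕ.+ J ℕ.* suc m) ≈ e * y
      e₂ = trans (^-congʳ q (ℕ-Solver.solve 2 (λ J m → J ⊗ J ⊕ J ⊗ (:con 1 ⊕ m) ≔ (J ⊗ J ⊕ J ⊗ m) ⊕ J) ≡.refl J m))
             (^-homo-* q (J ℕ.* J ℕ.+ J ℕ.* m) J)

    -- Raising `m` by one changes the partial sum only by a multiple of its next term, which is
    -- divisible by q^(J²). This is why the limit does not depend on `m`.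
    durfee-step : ∀ m J → ∑ J (durfeeTerm m) + (1# - q ^ J) * durfeeTerm m J ≈ ∑ J (durfeeTerm (suc m))
    durfee-step m zero    = solve 2 (λ z t → z :+ (𝟙 :- 𝟙) :* t := z) refl 0# (durfeeTerm m 0)
    durfee-step m (suc J) = begin
      ∑ (suc J) (durfeeTerm m) + (1# - q ^ suc J) * t₁
        ≈⟨ +-congʳ (∑-last J (durfeeTerm m)) ⟩
      ∑ J (durfeeTerm m) + durfeeTerm m J + (1# - q ^ suc J) * t₁
        ≈⟨ +-assoc _ _ _ ⟩
      ∑ J (durfeeTerm m) + (durfeeTerm m J + (1# - q ^ suc J) * t₁)
        ≈⟨ +-congˡ (durfeeTerm-difference m J) ⟩
      ∑ J (durfeeTerm m) + ((1# - q ^ J) * durfeeTerm m J + durfeeTerm (suc m) J)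
        ≈⟨ +-assoc _ _ _ ⟨
      ∑ J (durfeeTerm m) + (1# - q ^ J) * durfeeTerm m J + durfeeTerm (suc m) J
        ≈⟨ +-congʳ (durfee-step m J) ⟩
      ∑ J (durfeeTerm (suc m)) + durfeeTerm (suc m) J
        ≈⟨ ∑-last J (durfeeTerm (suc m)) ⟨
      ∑ (suc J) (durfeeTerm (suc m)) ∎
      where t₁ = durfeeTerm m (suc J)

    -- h⁻ n k = h (n ∸ k) for k ≤ n, and 0 for k > n.
    h⁻ : ℕ → ℕ → Carrier
    h⁻ n       zero    = h n
    h⁻ zero    (suc k) = 0#
    h⁻ (suc n) (suc k) = h⁻ n k

    h⁻-zero : ∀ {n k} → n ℕ.< k → h⁻ n k ≈ 0#
    h⁻-zero {zero}  (s≤s n<k) = refl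
    h⁻-zero {suc n} (s≤s n<k) = h⁻-zero n<k

    -- This is h (n - k - 1) = (1 - qⁿ⁻ᵏ) h (n - k), multiplied by qᵏ to avoid the subtraction. It
    -- persists at k = n, where qᵏ - qⁿ = 0, and beyond, where `h⁻` vanishes.
    h⁻-suc : ∀ n k → q ^ k * h⁻ n (suc k) ≈ (q ^ k - q ^ n) * h⁻ n k
    h⁻-suc zero    zero    = trans (zeroʳ 1#) (sym (trans (*-congʳ (-‿inverseʳ 1#)) (zeroˡ (h 0))))
    h⁻-suc zero    (suc k) = trans (zeroʳ _) (sym (zeroʳ _))
    h⁻-suc (suc n) zero    = trans (*-identityˡ (h n)) (sym (h-suc n))
    h⁻-suc (suc n) (suc k) = begin
      q * q ^ k * h⁻ n (suc k)               ≈⟨ *-assoc _ _ _ ⟩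
      q * (q ^ k * h⁻ n (suc k))             ≈⟨ *-congˡ (h⁻-suc n k) ⟩
      q * ((q ^ k - q ^ n) * h⁻ n k)         ≈⟨ solve 4 (λ q a b h → q :* ((a :- b) :* h) := (q :* a :- q :* b) :* h) refl q (q ^ k) (q ^ n) (h⁻ n k) ⟩
      (q * q ^ k - q * q ^ n) * h⁻ n k       ∎

    factorial : ℕ → Carrier
    factorial zero    = 1#
    factorial (suc n) = factorial n * (1# - q ^ suc n)

    factorial*h : ∀ n → factorial n * h n ≈ 1#
    factorial*h zero    = trans (*-identityˡ (h 0)) h-zero
    factorial*h (suc n) = trans (*-assoc _ _ _) (trans (*-congˡ (h-suc n)) (factorial*h n))

    -- The factor is a unit, with inverse (q;q)ₙ / (q;q)ₙ₊₁, that is `factorial n * h (suc n)`.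
    [1-q^n]-cancelˡ : ∀ n {x y} → (1# - q ^ suc n) * x ≈ (1# - q ^ suc n) * y → x ≈ y
    [1-q^n]-cancelˡ n {x} {y} e = begin
      x                    ≈⟨ inverse x ⟨
      g * (a * x)          ≈⟨ *-congˡ e ⟩
      g * (a * y)          ≈⟨ inverse y ⟩
      y                    ∎
      where
      a = 1# - q ^ suc n
      g = factorial n * h (suc n)
      inverse : ∀ z → g * (a * z) ≈ z
      inverse z = begin
        g * (a * z)                        ≈⟨ solve 4 (λ f h a z → f :* h :* (a :* z) := f :* a :* h :* z) refl (factorial n) (h (suc n)) a z ⟩
        factorial n * a * h (suc n) * z    ≈⟨ *-congʳ (factorial*h (suc n)) ⟩
        1# * z                             ≈⟨ *-identityˡ z ⟩
        z                                  ∎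

  ∑-shift : ∀ n f → f 0 ≈ 0# → f n ≈ 0# → ∑ n f ≈ ∑ n (f ∘ suc)
  ∑-shift n f f0≈0 fn≈0 = begin
    ∑ n f                    ≈⟨ +-identityʳ _ ⟨
    ∑ n f + 0#               ≈⟨ +-congˡ fn≈0 ⟨
    ∑ n f + f n              ≈⟨ ∑-last n f ⟨
    f 0 + ∑ n (f ∘ suc)      ≈⟨ +-congʳ f0≈0 ⟩
    0# + ∑ n (f ∘ suc)       ≈⟨ +-identityˡ _ ⟩
    ∑ n (f ∘ suc)            ∎

  ∑-linear : ∀ n c d f g e → ∑ n f + c * ∑ n g - d * ∑ n e ≈ ∑ n (λ k → f k + c * g k - d * e k)
  ∑-linear zero    c d f g e = begin
    0# + c * 0# - d * 0#   ≈⟨ +-cong (+-congˡ (zeroʳ c)) (-‿cong (zeroʳ d)) ⟩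
    0# + 0# - 0#           ≈⟨ solve 1 (λ z → z :+ z :- z := z) refl 0# ⟩
    0#                     ∎
  ∑-linear (suc n) c d f g e = begin
    f 0 + F + c * (g 0 + G) - d * (e 0 + E)
      ≈⟨ solve 8 (λ c d f F g G e E → f :+ F :+ c :* (g :+ G) :- d :* (e :+ E) := (f :+ c :* g :- d :* e) :+ (F :+ c :* G :- d :* E))
           refl c d (f 0) F (g 0) G (e 0) E ⟩
    f 0 + c * g 0 - d * e 0 + (F + c * G - d * E)
      ≈⟨ +-congˡ (∑-linear n c d (f ∘ suc) (g ∘ suc) (e ∘ suc)) ⟩
    ∑ (suc n) (λ k → f k + c * g k - d * e k) ∎
    where
    F = ∑ n (f ∘ suc)
    G = ∑ n (g ∘ suc)
    E = ∑ n (e ∘ suc)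

  -- A polynomial p(x) is represented by its values φ i = p(qⁱ); T is then the
  -- operator x + (q - 1) s D for s = -u = -1/q.
  module Operator (q u : Carrier) (qu≈1 : q * u ≈ 1#) where

    T : (ℕ → Carrier) → ℕ → Carrier
    T φ i = q ^ i * φ i + u ^ suc i * (φ i - φ (suc i))

    T-cong : ∀ {φ ψ} → (∀ i → φ i ≈ ψ i) → ∀ i → T φ i ≈ T ψ i
    T-cong e i = +-cong (*-congˡ (e i)) (*-congˡ (+-cong (e i) (-‿cong (e (suc i)))))

    T-linear : ∀ c φ ψ i → T (λ i → c * φ i + ψ i) i ≈ c * T φ i + T ψ i
    T-linear c φ ψ i =
      solve 7 (λ c x y a b a′ b′ → x :* (c :* a :+ b) :+ y :* ((c :* a :+ b) :- (c :* a′ :+ b′))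
                 := c :* (x :* a :+ y :* (a :- a′)) :+ (x :* b :+ y :* (b :- b′)))
        refl c (q ^ i) (u ^ suc i) (φ i) (ψ i) (φ (suc i)) (ψ (suc i))

    T-∑ : ∀ n (c : ℕ → Carrier) (φ : ℕ → ℕ → Carrier) i → T (λ i → ∑ n (λ k → c k * φ k i)) i ≈ ∑ n (λ k → c k * T (φ k) i)
    T-∑ zero    c φ i = trans (+-cong (zeroʳ _) (trans (*-congˡ (-‿inverseʳ 0#)) (zeroʳ _))) (+-identityˡ 0#)
    T-∑ (suc n) c φ i =
      trans (T-linear (c 0) (φ 0) (λ i → ∑ n (λ k → c (suc k) * φ (suc k) i)) i) (+-congˡ (T-∑ n (c ∘ suc) (φ ∘ suc) i))

    monomial : ℕ → ℕ → Carrier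
    monomial n i = (q ^ i) ^ n

    q^i*u^i≈1 : ∀ i → q ^ i * u ^ i ≈ 1#
    q^i*u^i≈1 = inverse-^ qu≈1

    monomial-suc : ∀ n i → monomial n (suc i) ≈ q ^ n * monomial n i
    monomial-suc n i = ^-distrib-* q (q ^ i) n

    T-monomial-zero : ∀ i → T (monomial 0) i ≈ monomial 1 i
    T-monomial-zero i = solve 2 (λ x y → x :* 𝟙 :+ y :* (𝟙 :- 𝟙) := x :* 𝟙) refl (q ^ i) (u ^ suc i)

    T-monomial-suc : ∀ n i → T (monomial (suc n)) i ≈ monomial (2 ℕ.+ n) i + u * ((1# - q ^ suc n) * monomial n i)
    T-monomial-suc n i = begin
      x * (x * X) + u * y * (x * X - monomial (suc n) (suc i))
        ≈⟨ +-congˡ (*-congˡ (+-congˡ (-‿cong (monomial-suc (suc n) i)))) ⟩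
      x * (x * X) + u * y * (x * X - q ^ suc n * (x * X))
        ≈⟨ solve 5 (λ u x y X Q → x :* (x :* X) :+ u :* y :* (x :* X :- Q :* (x :* X))
                      := x :* (x :* X) :+ u :* ((𝟙 :- Q) :* X) :+ (x :* y :- 𝟙) :* (u :* ((𝟙 :- Q) :* X))) refl u x y X (q ^ suc n) ⟩
      x * (x * X) + u * ((1# - q ^ suc n) * X) + (x * y - 1#) * (u * ((1# - q ^ suc n) * X))
        ≈⟨ +-0*ʳ _ _ (q^i*u^i≈1 i) ⟩
      x * (x * X) + u * ((1# - q ^ suc n) * X) ∎
      where
      x = q ^ i
      y = u ^ i
      X = monomial n i

    -- Φ (suc n) j = ∑ₖ q^{k(k-1)/2} [n-k, k] (-q⁻ʲ)ᵏ, the Carlitz q-Fibonacci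
    -- polynomial at s = -q⁻ʲ; its definition and Φ-suc are the two Pascal rules.
    Φ : ℕ → ℕ → Carrier
    Φ 0             j = 0#
    Φ 1             j = 1#
    Φ (suc (suc n)) j = Φ (suc n) j - q ^ n * u ^ suc j * Φ n (suc j)

    Φ-suc : ∀ n j → Φ (2 ℕ.+ n) (suc j) ≈ Φ (suc n) j - u ^ suc j * Φ n j
    Φ-suc zero    j = trans (+-congˡ (-‿cong (zeroʳ _))) (sym (+-congˡ (-‿cong (zeroʳ _))))
    Φ-suc (suc zero) j = begin
      1# - 1# * (u * v) * 0# - q * 1# * (u * v) * 1#
        ≈⟨ solve 4 (λ q u v z → 𝟙 :- 𝟙 :* (u :* v) :* z :- q :* 𝟙 :* (u :* v) :* 𝟙
                      := (𝟙 :- 𝟙 :* v :* z :- v :* 𝟙) :+ (𝟙 :- u) :* v :* z :+ (q :* u :- 𝟙) :* :- v) refl q u v 0# ⟩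
      (1# - 1# * v * 0# - v * 1#) + (1# - u) * v * 0# + (q * u - 1#) * - v
        ≈⟨ +-0*ʳ _ _ qu≈1 ⟩
      (1# - 1# * v * 0# - v * 1#) + (1# - u) * v * 0#
        ≈⟨ trans (+-congˡ (zeroʳ _)) (+-identityʳ _) ⟩
      1# - 1# * v * 0# - v * 1# ∎
      where v = u ^ suc j
    Φ-suc (suc (suc n)) j = begin
      Φ (3 ℕ.+ n) (suc j) - q ^ (2 ℕ.+ n) * (u * v) * Φ (2 ℕ.+ n) (2 ℕ.+ j)
        ≈⟨ +-cong (Φ-suc (suc n) j) (-‿cong (*-congˡ (Φ-suc n (suc j)))) ⟩
      b - Q * v * d - v * b - q * (q * Q) * (u * v) * (c - u * v * d)
        ≈⟨ solve 7 (λ q u Q v b c d →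
             b :- Q :* v :* d :- v :* b :- q :* (q :* Q) :* (u :* v) :* (c :- u :* v :* d)
             := b :- Q :* v :* d :- q :* Q :* v :* c :- v :* (b :- Q :* v :* d)
                :+ (q :* u :- 𝟙) :* ((q :* u :+ 𝟙) :* Q :* v :* v :* d :- q :* Q :* v :* c)) refl q u Q v b c d ⟩
      b - Q * v * d - q * Q * v * c - v * (b - Q * v * d) + (q * u - 1#) * ((q * u + 1#) * Q * v * v * d - q * Q * v * c)
        ≈⟨ +-0*ʳ _ _ qu≈1 ⟩
      b - Q * v * d - q * Q * v * c - v * (b - Q * v * d) ∎
      where
      Q = q ^ n
      v = u ^ suc j
      b = Φ (suc n) j
      c = Φ (suc n) (suc j)
      d = Φ n (suc j)

    -- The first Pascal rule leads from j = 0 to j = 1, the second one back to j = 0. By the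
    -- induction hypothesis the two multiples of `Φ n 0` then cancel, because qⁿ⁺² u² = qⁿ.
    Φ-+3 : ∀ n → Φ (3 ℕ.+ n) 0 ≈ - (q ^ n * Φ n 0)
    Φ-+3 zero    = begin
      1# - 1# * (u * 1#) * 0# - q * 1# * (u * 1#) * 1#
        ≈⟨ solve 3 (λ q u z → 𝟙 :- 𝟙 :* (u :* 𝟙) :* z :- q :* 𝟙 :* (u :* 𝟙) :* 𝟙
                      := :- (𝟙 :* z) :+ (𝟙 :- u) :* z :+ (q :* u :- 𝟙) :* :- 𝟙) refl q u 0# ⟩
      - (1# * 0#) + (1# - u) * 0# + (q * u - 1#) * - 1#
        ≈⟨ +-0*ʳ _ _ qu≈1 ⟩
      - (1# * 0#) + (1# - u) * 0#
        ≈⟨ trans (+-congˡ (zeroʳ _)) (+-identityʳ _) ⟩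
      - (1# * 0#) ∎
    Φ-+3 (suc n) = begin
      Φ (3 ℕ.+ n) 0 - q ^ (2 ℕ.+ n) * (u * 1#) * Φ (2 ℕ.+ n) 1
        ≈⟨ +-cong (Φ-+3 n) (-‿cong (*-congˡ (Φ-suc n 0))) ⟩
      - (Q * a) - q * (q * Q) * (u * 1#) * (b - u * 1# * a)
        ≈⟨ solve 5 (λ q u Q a b → :- (Q :* a) :- q :* (q :* Q) :* (u :* 𝟙) :* (b :- u :* 𝟙 :* a)
                      := :- (q :* Q :* b) :+ (q :* u :- 𝟙) :* ((q :* u :+ 𝟙) :* Q :* a :- q :* Q :* b)) refl q u Q a b ⟩
      - (q * Q * b) + (q * u - 1#) * ((q * u + 1#) * Q * a - q * Q * b)
        ≈⟨ +-0*ʳ _ _ qu≈1 ⟩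
      - (q * Q * b) ∎
      where
      Q = q ^ n
      a = Φ n 0
      b = Φ (suc n) 0

    -- The Carlitz polynomial of degree n at s = -1. By homogeneity it is xⁿ times its value at x =
    -- 1 with s / x² in place of s; at x = qⁱ this is -q⁻²ⁱ, whence the second index 2i.
    U : ℕ → ℕ → Carrier
    U n i = monomial n i * Φ (suc n) (i ℕ.* 2)

    T-U-zero : ∀ i → T (U 0) i ≈ U 1 i
    T-U-zero i = begin
      x * (1# * 1#) + y * (1# * 1# - 1# * 1#)
        ≈⟨ solve 3 (λ x y w → x :* (𝟙 :* 𝟙) :+ y :* (𝟙 :* 𝟙 :- 𝟙 :* 𝟙) := x :* 𝟙 :* 𝟙) refl x y w ⟩
      x * 1# * 1#
        ≈⟨ *-congˡ (trans (+-congˡ (trans (-‿cong (zeroʳ w)) (solve 1 (λ z → :- z := z :- (z :+ z)) refl 0#))) (trans (+-congˡ (trans (+-congˡ (-‿cong (+-identityˡ 0#))) (-‿inverseʳ 0#))) (+-identityʳ 1#))) ⟨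
      x * 1# * (1# - w * 0#) ∎
      where
      x = q ^ i
      y = u ^ suc i
      w = 1# * u ^ suc (i ℕ.* 2)

    -- This is the Fibonacci recurrence, identifying the explicit `U` with the Fibonacci polynomials
    -- of T. Passing from x to qx raises the second index of `Φ` by 2; `Φ-suc` lowers it to 2i + 1,
    -- the index that also occurs when `Φ (3 + n)` is unfolded.
    T-U-suc : ∀ n i → T (U (suc n)) i ≈ U (2 ℕ.+ n) i + u * U n i
    T-U-suc n i = begin
      x * (x * X * (A - Q * (u * v) * C)) + u * y * (x * X * (A - Q * (u * v) * C) - monomial (suc n) (suc i) * Φ (2 ℕ.+ n) (2 ℕ.+ i ℕ.* 2))
        ≈⟨ +-congˡ (*-congˡ (+-congˡ (-‿cong (*-cong (monomial-suc (suc n) i) (Φ-suc n (suc (i ℕ.* 2))))))) ⟩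
      x * (x * X * (A - Q * (u * v) * C)) + u * y * (x * X * (A - Q * (u * v) * C) - q * Q * (x * X) * (B - u * (u * v) * C))
        ≈⟨ reduce v ⟩
      x * (x * X) * (A - Q * (u * v) * C - q * Q * (u * v) * B) + u * (X * A)
        + (v - y * y) * K + (q * u - 1#) * k + (x * y - 1#) * k′
        ≈⟨ +-0*ʳ _ _ (q^i*u^i≈1 i) ⟩
      x * (x * X) * (A - Q * (u * v) * C - q * Q * (u * v) * B) + u * (X * A)
        + (v - y * y) * K + (q * u - 1#) * k
        ≈⟨ +-0*ʳ _ _ qu≈1 ⟩
      x * (x * X) * (A - Q * (u * v) * C - q * Q * (u * v) * B) + u * (X * A) + (v - y * y) * K
        ≈⟨ +-congˡ (trans (*-congʳ (trans (+-congʳ (x^n*2≈x^n*x^n u i)) (-‿inverseʳ _))) (zeroˡ _)) ⟩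
      x * (x * X) * (A - Q * (u * v) * C - q * Q * (u * v) * B) + u * (X * A) + 0#
        ≈⟨ +-identityʳ _ ⟩
      x * (x * X) * (A - Q * (u * v) * C - q * Q * (u * v) * B) + u * (X * A) ∎
      where
      x = q ^ i
      y = u ^ i
      v = u ^ (i ℕ.* 2)
      X = monomial n i
      Q = q ^ n
      A = Φ (suc n) (i ℕ.* 2)
      B = Φ (suc n) (suc (i ℕ.* 2))
      C = Φ n (suc (i ℕ.* 2))
      -- Cofactors of the relations v = y², q u = 1 and x y = 1, modulo which the two sides agree.
      K = x * x * X * q * Q * u * B - u * y * x * X * Q * u * C + u * y * q * Q * x * X * u * u * C
      k = x * y * X * Q * u * u * y * y * C
      k′ = u * X * A + x * y * q * Q * u * X * B
      reduce : ∀ v → x * (x * X * (A - Q * (u * v) * C)) + u * y * (x * X * (A - Q * (u * v) * C) - q * Q * (x * X) * (B - u * (u * v) * C))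
        ≈ x * (x * X) * (A - Q * (u * v) * C - q * Q * (u * v) * B) + u * (X * A)
          + (v - y * y) * K + (q * u - 1#) * k + (x * y - 1#) * k′
      reduce v = solve 10 (λ q u x y v X Q A B C →
        x :* (x :* X :* (A :- Q :* (u :* v) :* C)) :+ u :* y :* (x :* X :* (A :- Q :* (u :* v) :* C) :- q :* Q :* (x :* X) :* (B :- u :* (u :* v) :* C))
        := x :* (x :* X) :* (A :- Q :* (u :* v) :* C :- q :* Q :* (u :* v) :* B) :+ u :* (X :* A)
          :+ (v :- y :* y) :* (x :* x :* X :* q :* Q :* u :* B :- u :* y :* x :* X :* Q :* u :* C :+ u :* y :* q :* Q :* x :* X :* u :* u :* C)
          :+ (q :* u :- 𝟙) :* (x :* y :* X :* Q :* u :* u :* y :* y :* C)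
          :+ (x :* y :- 𝟙) :* (u :* X :* A :+ x :* y :* q :* Q :* u :* X :* B))
        refl q u x y v X Q A B C

    -- The right-hand side satisfies the same three-term recurrence as `v`, so n = 0 and n = 1
    -- decide. The case n = 1 stands apart because T U₀ = U₁ has no second summand.
    lucas-U : ∀ (v : ℕ → ℕ → Carrier) → (∀ i → v 0 i ≈ 1# + 1#) → (∀ i → v 1 i ≈ T (λ _ → 1#) i) →
      (∀ n i → v (2 ℕ.+ n) i ≈ T (v (suc n)) i - u * v n i) → ∀ n i → v (2 ℕ.+ n) i ≈ - u * U n i + U (2 ℕ.+ n) i
    lucas-U v v₀ v₁ v₂ = go
      where
      U₀≈1 : ∀ i → U 0 i ≈ 1#
      U₀≈1 i = *-identityˡ 1#
      v₁≈U₁ : ∀ i → v 1 i ≈ U 1 i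
      v₁≈U₁ i = trans (v₁ i) (trans (T-cong (λ i → sym (U₀≈1 i)) i) (T-U-zero i))
      go : ∀ n i → v (2 ℕ.+ n) i ≈ - u * U n i + U (2 ℕ.+ n) i
      go zero i = begin
        v 2 i                                  ≈⟨ v₂ 0 i ⟩
        T (v 1) i - u * v 0 i                  ≈⟨ +-cong (trans (T-cong v₁≈U₁ i) (T-U-suc 0 i)) (-‿cong (*-congˡ (v₀ i))) ⟩
        U 2 i + u * U 0 i - u * (1# + 1#)      ≈⟨ +-congˡ (-‿cong (*-congˡ (+-cong (U₀≈1 i) (U₀≈1 i)))) ⟨
        U 2 i + u * U 0 i - u * (U 0 i + U 0 i)
          ≈⟨ solve 3 (λ u a b → b :+ u :* a :- u :* (a :+ a) := :- u :* a :+ b) refl u (U 0 i) (U 2 i) ⟩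
        - u * U 0 i + U 2 i                    ∎
      go (suc zero) i = begin
        v 3 i                                      ≈⟨ v₂ 1 i ⟩
        T (v 2) i - u * v 1 i                      ≈⟨ +-cong (trans (T-cong (go 0) i) (T-linear (- u) (U 0) (U 2) i)) (-‿cong (*-congˡ (v₁≈U₁ i))) ⟩
        - u * T (U 0) i + T (U 2) i - u * U 1 i    ≈⟨ +-congʳ (+-cong (*-congˡ (T-U-zero i)) (T-U-suc 1 i)) ⟩
        - u * U 1 i + (U 3 i + u * U 1 i) - u * U 1 i
          ≈⟨ solve 3 (λ u a b → :- u :* a :+ (b :+ u :* a) :- u :* a := :- u :* a :+ b) refl u (U 1 i) (U 3 i) ⟩
        - u * U 1 i + U 3 i                        ∎
      go (suc (suc n)) i = begin
        v (4 ℕ.+ n) i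
          ≈⟨ v₂ (2 ℕ.+ n) i ⟩
        T (v (3 ℕ.+ n)) i - u * v (2 ℕ.+ n) i
          ≈⟨ +-cong (trans (T-cong (go (suc n)) i) (T-linear (- u) (U (suc n)) (U (3 ℕ.+ n)) i)) (-‿cong (*-congˡ (go n i))) ⟩
        - u * T (U (suc n)) i + T (U (3 ℕ.+ n)) i - u * (- u * U n i + U (2 ℕ.+ n) i)
          ≈⟨ +-congʳ (+-cong (*-congˡ (T-U-suc n i)) (T-U-suc (2 ℕ.+ n) i)) ⟩
        - u * (U (2 ℕ.+ n) i + u * U n i) + (U (4 ℕ.+ n) i + u * U (2 ℕ.+ n) i) - u * (- u * U n i + U (2 ℕ.+ n) i)
          ≈⟨ solve 4 (λ u a b c → :- u :* (b :+ u :* a) :+ (c :+ u :* b) :- u :* (:- u :* a :+ b) := :- u :* b :+ c)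
               refl u (U n i) (U (2 ℕ.+ n) i) (U (4 ℕ.+ n) i) ⟩
        - u * U (2 ℕ.+ n) i + U (4 ℕ.+ n) i ∎

    -- Inversion: powers of x in terms of `U`

    module Expansion (h : ℕ → Carrier) (h-zero : h 0 ≈ 1#) (h-suc : ∀ n → (1# - q ^ suc n) * h (suc n) ≈ h n) where

      open ReciprocalFactorials q h h-zero h-suc

      -- `evenCoeff n k` belongs to U₂ₖ in h (2n) x²ⁿ, and `oddCoeff n k` to U₂ₖ₊₁ in h (2n + 1)
      -- x²ⁿ⁺¹. The shifted versions are set up so as to vanish at n = 0 and at k = 0 respectively.
      evenCoeff evenCoeff⁻ oddCoeff oddCoeff⁻ : ℕ → ℕ → Carrier
      evenCoeff n k = h⁻ n k * h (suc (n ℕ.+ k)) * (1# - q ^ suc (k ℕ.* 2))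
      oddCoeff n k = h⁻ n k * h (2 ℕ.+ (n ℕ.+ k)) * (1# - q ^ (2 ℕ.+ k ℕ.* 2))
      -- oddCoeff (n - 1) k and oddCoeff n (k - 1)
      oddCoeff⁻ n k = h⁻ n (suc k) * h (suc (n ℕ.+ k)) * (1# - q ^ (2 ℕ.+ k ℕ.* 2))
      evenCoeff⁻ n zero    = 0#
      evenCoeff⁻ n (suc k) = oddCoeff n k

      private
        h-shift : ∀ n k → h (suc (n ℕ.+ k)) ≈ (1# - q * (q * (q ^ n * q ^ k))) * h (2 ℕ.+ (n ℕ.+ k))
        h-shift n k = trans (sym (h-suc (suc (n ℕ.+ k)))) (*-congʳ (+-congˡ (-‿cong (*-congˡ (*-congˡ (^-homo-* q n k))))))

      -- Comparison of the coefficients of U₂ₖ₊₁ in (1 - q²ⁿ⁺¹) h (2n + 1) x²ⁿ⁺¹ = T (h (2n) x²ⁿ) -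
      -- u h (2n - 1) x²ⁿ⁻¹, given that T Uₘ = Uₘ₊₁ + u Uₘ₋₁.
      oddCoeff-recurrence : ∀ n k →
        (1# - q ^ suc (n ℕ.* 2)) * oddCoeff n k ≈ evenCoeff n k + u * evenCoeff n (suc k) - u * oddCoeff⁻ n k
      oddCoeff-recurrence n k = begin
        (1# - q * q ^ (n ℕ.* 2)) * (H * K * (1# - q * (q * q ^ (k ℕ.* 2))))
          ≈⟨ *-cong (+-congˡ (-‿cong (*-congˡ (x^n*2≈x^n*x^n q n)))) (*-congˡ (+-congˡ (-‿cong (*-congˡ (*-congˡ (x^n*2≈x^n*x^n q k)))))) ⟩
        (1# - q * (b * b)) * (H * K * (1# - q * (q * (a * a))))
          -- The splitting isolates `(a - b) * H`, which `h⁻-suc` turns into `a * H′`.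
          ≈⟨ solve 5 (λ q a b H K →
               (𝟙 :- q :* (b :* b)) :* (H :* K :* (𝟙 :- q :* (q :* (a :* a))))
               := H :* ((𝟙 :- q :* (q :* (b :* a))) :* K) :* (𝟙 :- q :* (a :* a))
                  :+ q :* ((a :- b) :* H) :* K :* (a :+ b :- q :* a :- q :* q :* a :* a :* b)) refl q a b H K ⟩
        H * ((1# - q * (q * (b * a))) * K) * (1# - q * (a * a)) + q * ((a - b) * H) * K * P
          ≈⟨ +-cong refl (*-congʳ (*-congʳ (*-congˡ (sym (h⁻-suc n k))))) ⟩
        H * ((1# - q * (q * (b * a))) * K) * (1# - q * (a * a)) + q * (a * H′) * K * P
          ≈⟨ +-0*ʳ _ _ qu≈1 ⟨
        H * ((1# - q * (q * (b * a))) * K) * (1# - q * (a * a)) + q * (a * H′) * K * P + (q * u - 1#) * (q * (a * H′) * K * P)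
          ≈⟨ solve 7 (λ q u a b H H′ K →
               H :* ((𝟙 :- q :* (q :* (b :* a))) :* K) :* (𝟙 :- q :* (a :* a)) :+ q :* (a :* H′) :* K :* (a :+ b :- q :* a :- q :* q :* a :* a :* b)
                 :+ (q :* u :- 𝟙) :* (q :* (a :* H′) :* K :* (a :+ b :- q :* a :- q :* q :* a :* a :* b))
               := H :* ((𝟙 :- q :* (q :* (b :* a))) :* K) :* (𝟙 :- q :* (a :* a)) :+ u :* (H′ :* K :* (𝟙 :- q :* (q :* (q :* (a :* a)))))
                 :- u :* (H′ :* ((𝟙 :- q :* (q :* (b :* a))) :* K) :* (𝟙 :- q :* (q :* (a :* a)))))
               refl q u a b H H′ K ⟩
        H * ((1# - q * (q * (b * a))) * K) * (1# - q * (a * a)) + u * (H′ * K * (1# - q * (q * (q * (a * a)))))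
          - u * (H′ * ((1# - q * (q * (b * a))) * K) * (1# - q * (q * (a * a))))
          ≈⟨ +-cong (+-cong (*-cong (*-congˡ (h-shift n k)) (+-congˡ (-‿cong (*-congˡ (x^n*2≈x^n*x^n q k)))))
                            (*-congˡ (*-cong (*-congˡ (reflexive (≡.cong (h ∘ suc) (ℕ.+-suc n k)))) (+-congˡ (-‿cong (*-congˡ (*-congˡ (*-congˡ (x^n*2≈x^n*x^n q k)))))))))
                    (-‿cong (*-congˡ (*-cong (*-congˡ (h-shift n k)) (+-congˡ (-‿cong (*-congˡ (*-congˡ (x^n*2≈x^n*x^n q k)))))))) ⟨
        evenCoeff n k + u * evenCoeff n (suc k) - u * oddCoeff⁻ n k ∎
        where
        a = q ^ k
        b = q ^ n
        H = h⁻ n k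
        H′ = h⁻ n (suc k)
        K = h (2 ℕ.+ (n ℕ.+ k))
        P = a + b - q * a - q * q * a * a * b

      -- The same comparison for U₂ₖ; k = 0 is separate because there is no U₋₁ to contribute.
      evenCoeff-recurrence : ∀ n k →
        (1# - q ^ (2 ℕ.+ n ℕ.* 2)) * evenCoeff (suc n) k ≈ evenCoeff⁻ n k + u * oddCoeff n k - u * evenCoeff n k
      evenCoeff-recurrence n zero = begin
        (1# - q * (q * q ^ (n ℕ.* 2))) * (h (suc n) * h (2 ℕ.+ (n ℕ.+ 0)) * (1# - q * 1#))
          ≈⟨ *-cong (+-congˡ (-‿cong (*-congˡ (*-congˡ (x^n*2≈x^n*x^n q n))))) (*-congʳ (*-congʳ (reflexive (≡.cong (h ∘ suc) (≡.sym (ℕ.+-identityʳ n)))))) ⟩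
        (1# - q * (q * (b * b))) * (L * K * (1# - q * 1#))
          ≈⟨ solve 4 (λ q b L K → (𝟙 :- q :* (q :* (b :* b))) :* (L :* K :* (𝟙 :- q :* 𝟙))
                         := (𝟙 :- q :* b) :* L :* K :* (𝟙 :- q) :* (𝟙 :+ q :* b)) refl q b L K ⟩
        (1# - q * b) * L * K * (1# - q) * (1# + q * b)
          ≈⟨ trans (+-0*ʳ _ _ qu≈1) (+-identityˡ _) ⟨
        0# + (1# - q * b) * L * K * (1# - q) * (1# + q * b) + (q * u - 1#) * ((1# - q * b) * L * K * (1# - q) * (1# + q * b))
          ≈⟨ solve 6 (λ z q u b L K →
               z :+ (𝟙 :- q :* b) :* L :* K :* (𝟙 :- q) :* (𝟙 :+ q :* b) :+ (q :* u :- 𝟙) :* ((𝟙 :- q :* b) :* L :* K :* (𝟙 :- q) :* (𝟙 :+ q :* b))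
               := z :+ u :* ((𝟙 :- q :* b) :* L :* K :* (𝟙 :- q :* (q :* 𝟙))) :- u :* ((𝟙 :- q :* b) :* L :* ((𝟙 :- q :* (q :* (b :* 𝟙))) :* K) :* (𝟙 :- q :* 𝟙)))
               refl 0# q u b L K ⟩
        0# + u * ((1# - q * b) * L * K * (1# - q * (q * 1#))) - u * ((1# - q * b) * L * ((1# - q * (q * (b * 1#))) * K) * (1# - q * 1#))
          ≈⟨ +-cong (+-congˡ (*-congˡ (*-congʳ (*-congʳ hn)))) (-‿cong (*-congˡ (*-congʳ (*-cong hn (h-shift n 0))))) ⟨
        0# + u * (h n * K * (1# - q * (q * 1#))) - u * (h n * L * (1# - q * 1#)) ∎
        where
        b = q ^ n
        K = h (2 ℕ.+ (n ℕ.+ 0))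
        L = h (suc (n ℕ.+ 0))
        hn : h n ≈ (1# - q * b) * L
        hn = trans (sym (h-suc n)) (*-congˡ (reflexive (≡.cong (h ∘ suc) (≡.sym (ℕ.+-identityʳ n)))))
      evenCoeff-recurrence n (suc k) = begin
        (1# - q * (q * q ^ (n ℕ.* 2))) * (H * K * (1# - q * (q * (q * q ^ (k ℕ.* 2)))))
          ≈⟨ *-cong (+-congˡ (-‿cong (*-congˡ (*-congˡ (x^n*2≈x^n*x^n q n))))) (*-congˡ (+-congˡ (-‿cong (*-congˡ (*-congˡ (*-congˡ (x^n*2≈x^n*x^n q k))))))) ⟩
        (1# - q * (q * (b * b))) * (H * K * (1# - q * (q * (q * (a * a)))))
          ≈⟨ solve 5 (λ q a b H K →
               (𝟙 :- q :* (q :* (b :* b))) :* (H :* K :* (𝟙 :- q :* (q :* (q :* (a :* a)))))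
               := H :* ((𝟙 :- q :* (q :* (b :* (q :* a)))) :* K) :* (𝟙 :- q :* (q :* (a :* a)))
                  :+ q :* q :* ((a :- b) :* H) :* K :* (a :+ b :- q :* a :- q :* q :* q :* a :* a :* b)) refl q a b H K ⟩
        H * ((1# - q * (q * (b * (q * a)))) * K) * (1# - q * (q * (a * a))) + q * q * ((a - b) * H) * K * P
          ≈⟨ +-cong refl (*-congʳ (*-congʳ (*-congˡ (sym (h⁻-suc n k))))) ⟩
        H * ((1# - q * (q * (b * (q * a)))) * K) * (1# - q * (q * (a * a))) + q * q * (a * H′) * K * P
          ≈⟨ +-0*ʳ _ _ qu≈1 ⟨
        H * ((1# - q * (q * (b * (q * a)))) * K) * (1# - q * (q * (a * a))) + q * q * (a * H′) * K * P + (q * u - 1#) * (q * q * (a * H′) * K * P)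
          ≈⟨ solve 7 (λ q u a b H H′ K →
               H :* ((𝟙 :- q :* (q :* (b :* (q :* a)))) :* K) :* (𝟙 :- q :* (q :* (a :* a))) :+ q :* q :* (a :* H′) :* K :* (a :+ b :- q :* a :- q :* q :* q :* a :* a :* b)
                 :+ (q :* u :- 𝟙) :* (q :* q :* (a :* H′) :* K :* (a :+ b :- q :* a :- q :* q :* q :* a :* a :* b))
               := H :* ((𝟙 :- q :* (q :* (b :* (q :* a)))) :* K) :* (𝟙 :- q :* (q :* (a :* a))) :+ u :* (H′ :* K :* (𝟙 :- q :* (q :* (q :* (q :* (a :* a))))))
                 :- u :* (H′ :* ((𝟙 :- q :* (q :* (b :* (q :* a)))) :* K) :* (𝟙 :- q :* (q :* (q :* (a :* a))))))
               refl q u a b H H′ K ⟩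
        H * ((1# - q * (q * (b * (q * a)))) * K) * (1# - q * (q * (a * a))) + u * (H′ * K * (1# - q * (q * (q * (q * (a * a))))))
          - u * (H′ * ((1# - q * (q * (b * (q * a)))) * K) * (1# - q * (q * (q * (a * a)))))
          ≈⟨ +-cong (+-cong (*-congʳ (*-congˡ (h-shift n (suc k)))) refl) (-‿cong (*-congˡ (*-congʳ (*-congˡ (h-shift n (suc k)))))) ⟨
        H * L * (1# - q * (q * (a * a))) + u * (H′ * K * (1# - q * (q * (q * (q * (a * a))))))
          - u * (H′ * L * (1# - q * (q * (q * (a * a)))))
          ≈⟨ +-cong (+-cong (*-cong (*-congˡ (reflexive (≡.cong (h ∘ suc) (≡.sym (ℕ.+-suc n k))))) (+-congˡ (-‿cong (*-congˡ (*-congˡ (x^n*2≈x^n*x^n q k))))))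
                            (*-congˡ (*-congˡ (+-congˡ (-‿cong (*-congˡ (*-congˡ (*-congˡ (*-congˡ (x^n*2≈x^n*x^n q k)))))))))) 
                    (-‿cong (*-congˡ (*-congˡ (+-congˡ (-‿cong (*-congˡ (*-congˡ (*-congˡ (x^n*2≈x^n*x^n q k))))))))) ⟨
        oddCoeff n k + u * oddCoeff n (suc k) - u * evenCoeff n (suc k) ∎
        where
        a = q ^ k
        b = q ^ n
        H = h⁻ n k
        H′ = h⁻ n (suc k)
        K = h (2 ℕ.+ (n ℕ.+ suc k))
        L = h (suc (n ℕ.+ suc k))
        P = a + b - q * a - q * q * q * a * a * b

      -- The coefficients vanish for k > n, so one bound `M` > n can serve several n at once, and
      -- sums for different n combine termwise.
      evenSum oddSum oddSum⁻ : ℕ → ℕ → ℕ → Carrier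
      evenSum M n i = ∑ M (λ k → evenCoeff n k * U (k ℕ.* 2) i)
      oddSum M n i = ∑ M (λ k → oddCoeff n k * U (suc (k ℕ.* 2)) i)
      oddSum⁻ M n i = ∑ M (λ k → oddCoeff⁻ n k * U (suc (k ℕ.* 2)) i)

      h⁻-product-zero : ∀ {n k} → n ℕ.< k → ∀ x y z → h⁻ n k * x * y * z ≈ 0#
      h⁻-product-zero n<k x y z =
        trans (*-congʳ (*-congʳ (trans (*-congʳ (h⁻-zero n<k)) (zeroˡ x)))) (trans (*-congʳ (zeroˡ y)) (zeroˡ z))

      oddSum-recurrence : ∀ {M n} → n ℕ.< M → ∀ i →
        (1# - q ^ suc (n ℕ.* 2)) * oddSum M n i ≈ T (evenSum M n) i - u * oddSum⁻ M n i
      oddSum-recurrence {M} {n} n<M i = sym (begin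
        T (evenSum M n) i - u * oddSum⁻ M n i
          ≈⟨ +-congʳ (T-∑ M (evenCoeff n) (λ k → U (k ℕ.* 2)) i) ⟩
        ∑ M (λ k → evenCoeff n k * T (U (k ℕ.* 2)) i) - u * oddSum⁻ M n i
          ≈⟨ +-congʳ (∑-cong M λ k → trans (*-congˡ (T-U k)) (solve 4 (λ c v u w → c :* (v :+ u :* w) := c :* v :+ u :* (c :* w)) refl (evenCoeff n k) (V k) u (V⁻ k))) ⟩
        ∑ M (λ k → evenCoeff n k * V k + u * (evenCoeff n k * V⁻ k)) - u * oddSum⁻ M n i
          ≈⟨ +-congʳ (trans (∑-+ M E (λ k → u * E⁻ k)) (+-congˡ (sym (∑-*ˡ M u E⁻)))) ⟩
        ∑ M (λ k → evenCoeff n k * V k) + u * ∑ M (λ k → evenCoeff n k * V⁻ k) - u * oddSum⁻ M n i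
          -- Reindexing loses nothing: U₀ has no predecessor, and the coefficient at k = `M`
          -- vanishes since n < `M`.
          ≈⟨ +-congʳ (+-congˡ (*-congˡ (∑-shift M E⁻ (zeroʳ _) (h⁻-product-zero n<M _ _ _)))) ⟩
        ∑ M (λ k → evenCoeff n k * V k) + u * ∑ M (λ k → evenCoeff n (suc k) * V k) - u * oddSum⁻ M n i
          ≈⟨ ∑-linear M u u E (λ k → evenCoeff n (suc k) * V k) (λ k → oddCoeff⁻ n k * V k) ⟩
        ∑ M (λ k → evenCoeff n k * V k + u * (evenCoeff n (suc k) * V k) - u * (oddCoeff⁻ n k * V k))
          ≈⟨ ∑-cong M (λ k → trans
               (solve 5 (λ u v a b c → a :* v :+ u :* (b :* v) :- u :* (c :* v) := (a :+ u :* b :- u :* c) :* v) refl u (V k) _ _ _)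
               (trans (*-congʳ (sym (oddCoeff-recurrence n k))) (*-assoc _ _ _))) ⟩
        ∑ M (λ k → (1# - q ^ suc (n ℕ.* 2)) * (oddCoeff n k * V k))
          ≈⟨ ∑-*ˡ M _ (λ k → oddCoeff n k * V k) ⟨
        (1# - q ^ suc (n ℕ.* 2)) * oddSum M n i ∎)
        where
        V V⁻ : ℕ → Carrier
        V k = U (suc (k ℕ.* 2)) i
        V⁻ zero    = 0#
        V⁻ (suc k) = V k
        E E⁻ : ℕ → Carrier
        E k = evenCoeff n k * V k
        E⁻ k = evenCoeff n k * V⁻ k
        T-U : ∀ k → T (U (k ℕ.* 2)) i ≈ V k + u * V⁻ k
        T-U zero    = trans (T-U-zero i) (sym (trans (+-congˡ (zeroʳ u)) (+-identityʳ _)))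
        T-U (suc k) = T-U-suc (suc (k ℕ.* 2)) i

      evenSum-recurrence : ∀ {M n} → suc n ℕ.< M → ∀ i →
        (1# - q ^ (2 ℕ.+ n ℕ.* 2)) * evenSum M (suc n) i ≈ T (oddSum M n) i - u * evenSum M n i
      evenSum-recurrence {suc M} {n} (s≤s n<M) i = sym (begin
        T (oddSum (suc M) n) i - u * evenSum (suc M) n i
          ≈⟨ +-congʳ (T-∑ (suc M) (oddCoeff n) (λ k → U (suc (k ℕ.* 2))) i) ⟩
        ∑ (suc M) (λ k → oddCoeff n k * T (U (suc (k ℕ.* 2))) i) - u * evenSum (suc M) n i
          ≈⟨ +-congʳ (∑-cong (suc M) λ k → trans (*-congˡ (T-U-suc (k ℕ.* 2) i)) (solve 4 (λ c v u w → c :* (v :+ u :* w) := c :* v :+ u :* (c :* w)) refl (oddCoeff n k) (V (suc k)) u (V k))) ⟩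
        ∑ (suc M) (λ k → oddCoeff n k * V (suc k) + u * (oddCoeff n k * V k)) - u * evenSum (suc M) n i
          ≈⟨ +-congʳ (trans (∑-+ (suc M) (λ k → O k * V (suc k)) (λ k → u * (O k * V k))) (+-congˡ (sym (∑-*ˡ (suc M) u (λ k → O k * V k))))) ⟩
        ∑ (suc M) (λ k → oddCoeff n k * V (suc k)) + u * ∑ (suc M) (λ k → oddCoeff n k * V k) - u * evenSum (suc M) n i
          ≈⟨ +-congʳ (+-congʳ (∑-shift (suc M) (λ k → evenCoeff⁻ n k * V k) (zeroˡ _) (h⁻-product-zero n<M _ _ _))) ⟨
        ∑ (suc M) (λ k → evenCoeff⁻ n k * V k) + u * ∑ (suc M) (λ k → oddCoeff n k * V k) - u * evenSum (suc M) n i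
          ≈⟨ ∑-linear (suc M) u u (λ k → evenCoeff⁻ n k * V k) (λ k → O k * V k) (λ k → evenCoeff n k * V k) ⟩
        ∑ (suc M) (λ k → evenCoeff⁻ n k * V k + u * (oddCoeff n k * V k) - u * (evenCoeff n k * V k))
          ≈⟨ ∑-cong (suc M) (λ k → trans
               (solve 5 (λ u v a b c → a :* v :+ u :* (b :* v) :- u :* (c :* v) := (a :+ u :* b :- u :* c) :* v) refl u (V k) _ _ _)
               (trans (*-congʳ (sym (evenCoeff-recurrence n k))) (*-assoc _ _ _))) ⟩
        ∑ (suc M) (λ k → (1# - q ^ (2 ℕ.+ n ℕ.* 2)) * (evenCoeff (suc n) k * V k))
          ≈⟨ ∑-*ˡ (suc M) _ (λ k → evenCoeff (suc n) k * V k) ⟨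
        (1# - q ^ (2 ℕ.+ n ℕ.* 2)) * evenSum (suc M) (suc n) i ∎)
        where
        V O : ℕ → Carrier
        V k = U (k ℕ.* 2) i
        O k = oddCoeff n k

      -- The weight h absorbs the factor 1 - qᴺ⁺¹ produced by T, and u h N xᴺ cancels. The weighted
      -- powers thus obey the recurrence that governs `evenSum` and `oddSum`.
      T-monomial-step : ∀ N i →
        T (λ i → h (suc N) * monomial (suc N) i) i - u * (h N * monomial N i) ≈ (1# - q ^ (2 ℕ.+ N)) * (h (2 ℕ.+ N) * monomial (2 ℕ.+ N) i)
      T-monomial-step N i = begin
        x * (g * (x * X)) + y * (g * (x * X) - g * Y) - u * (h N * X)
          ≈⟨ solve 8 (λ x y g w Y u p X → x :* (g :* w) :+ y :* (g :* w :- g :* Y) :- u :* (p :* X) := g :* (x :* w :+ y :* (w :- Y)) :- u :* (p :* X))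
               refl x y g (x * X) Y u (h N) X ⟩
        g * T (monomial (suc N)) i - u * (h N * X)
          ≈⟨ +-cong (*-congˡ (T-monomial-suc N i)) (-‿cong (*-congˡ (*-congʳ (sym (h-suc N))))) ⟩
        g * (monomial (2 ℕ.+ N) i + u * (a * X)) - u * (a * g * X)
          ≈⟨ solve 5 (λ g m u a X → g :* (m :+ u :* (a :* X)) :- u :* (a :* g :* X) := g :* m) refl g (monomial (2 ℕ.+ N) i) u a X ⟩
        g * monomial (2 ℕ.+ N) i
          ≈⟨ *-congʳ (h-suc (suc N)) ⟨
        (1# - q ^ (2 ℕ.+ N)) * h (2 ℕ.+ N) * monomial (2 ℕ.+ N) i
          ≈⟨ *-assoc _ _ _ ⟩
        (1# - q ^ (2 ℕ.+ N)) * (h (2 ℕ.+ N) * monomial (2 ℕ.+ N) i) ∎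
        where
        x = q ^ i
        y = u ^ suc i
        X = monomial N i
        Y = monomial (suc N) (suc i)
        g = h (suc N)
        a = 1# - q ^ suc N

      -- Induction on the degree, alternating between even and odd. Both sides satisfy the same
      -- recurrence after multiplication by 1 - q^(degree), a unit that is then cancelled.
      even-expansion : ∀ {M} n → n ℕ.< M → ∀ i → evenSum M n i ≈ h (n ℕ.* 2) * monomial (n ℕ.* 2) i
      odd-expansion : ∀ {M} n → n ℕ.< M → ∀ i → oddSum M n i ≈ h (suc (n ℕ.* 2)) * monomial (suc (n ℕ.* 2)) i

      even-expansion {suc M} zero n<M i = begin
        h 0 * h 1 * (1# - q ^ 1) * (1# * 1#) + ∑ M (λ k → evenCoeff 0 (suc k) * U (suc k ℕ.* 2) i)
          ≈⟨ +-congˡ (trans (∑-cong M {λ k → evenCoeff 0 (suc k) * U (suc k ℕ.* 2) i} λ k → h⁻-product-zero {0} {suc k} (s≤s z≤n) _ _ _) (∑-zero M)) ⟩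
        h 0 * h 1 * (1# - q ^ 1) * (1# * 1#) + 0#
          ≈⟨ +-identityʳ _ ⟩
        h 0 * h 1 * (1# - q ^ 1) * (1# * 1#)
          ≈⟨ solve 3 (λ a b c → a :* b :* c :* (𝟙 :* 𝟙) := a :* (c :* b)) refl (h 0) (h 1) (1# - q ^ 1) ⟩
        h 0 * ((1# - q ^ 1) * h 1)
          ≈⟨ *-congˡ (trans (h-suc 0) h-zero) ⟩
        h 0 * 1# ∎
      even-expansion {M} (suc n) n<M i = [1-q^n]-cancelˡ (suc (n ℕ.* 2)) (begin
        (1# - q ^ (2 ℕ.+ n ℕ.* 2)) * evenSum M (suc n) i
          ≈⟨ evenSum-recurrence n<M i ⟩
        T (oddSum M n) i - u * evenSum M n i
          ≈⟨ +-cong (T-cong (odd-expansion n n<M′) i) (-‿cong (*-congˡ (even-expansion n n<M′ i))) ⟩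
        T (λ i → h (suc (n ℕ.* 2)) * monomial (suc (n ℕ.* 2)) i) i - u * (h (n ℕ.* 2) * monomial (n ℕ.* 2) i)
          ≈⟨ T-monomial-step (n ℕ.* 2) i ⟩
        (1# - q ^ (2 ℕ.+ n ℕ.* 2)) * (h (2 ℕ.+ n ℕ.* 2) * monomial (2 ℕ.+ n ℕ.* 2) i) ∎)
        where n<M′ = ℕ.<-trans (ℕ.n<1+n n) n<M

      odd-expansion {M} zero n<M i = [1-q^n]-cancelˡ 0 (begin
        (1# - q ^ 1) * oddSum M 0 i
          ≈⟨ oddSum-recurrence n<M i ⟩
        T (evenSum M 0) i - u * oddSum⁻ M 0 i
          -- All `oddCoeff⁻ 0 k` vanish, in keeping with the absence of a power x⁻¹.
          ≈⟨ +-cong (T-cong (even-expansion 0 n<M) i)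
               (-‿cong (trans (*-congˡ (trans (∑-cong M {λ k → oddCoeff⁻ 0 k * U (suc (k ℕ.* 2)) i} λ k → h⁻-product-zero {0} {suc k} (s≤s z≤n) _ _ _) (∑-zero M))) (zeroʳ u))) ⟩
        T (λ i → h 0 * 1#) i - 0#
          ≈⟨ +-congʳ (T-cong (λ i → trans (*-congʳ h-zero) (*-identityˡ 1#)) i) ⟩
        T (monomial 0) i - 0#
          ≈⟨ +-cong (T-monomial-zero i) (trans (solve 1 (λ z → :- z := z :- (z :+ z)) refl 0#) (trans (+-congˡ (-‿cong (+-identityˡ 0#))) (-‿inverseʳ 0#))) ⟩
        monomial 1 i + 0#
          ≈⟨ +-identityʳ _ ⟩
        monomial 1 i
          ≈⟨ trans (*-congʳ (trans (h-suc 0) h-zero)) (*-identityˡ _) ⟨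
        (1# - q ^ 1) * h 1 * monomial 1 i
          ≈⟨ *-assoc _ _ _ ⟩
        (1# - q ^ 1) * (h 1 * monomial 1 i) ∎)
      odd-expansion {M} (suc n) n<M i = [1-q^n]-cancelˡ (2 ℕ.+ n ℕ.* 2) (begin
        (1# - q ^ (3 ℕ.+ n ℕ.* 2)) * oddSum M (suc n) i
          -- `oddSum⁻ M (suc n)` computes to `oddSum M n`.
          ≈⟨ oddSum-recurrence n<M i ⟩
        T (evenSum M (suc n)) i - u * oddSum M n i
          ≈⟨ +-cong (T-cong (even-expansion (suc n) n<M) i) (-‿cong (*-congˡ (odd-expansion n (ℕ.<-trans (ℕ.n<1+n n) n<M) i))) ⟩
        T (λ i → h (2 ℕ.+ n ℕ.* 2) * monomial (2 ℕ.+ n ℕ.* 2) i) i - u * (h (suc (n ℕ.* 2)) * monomial (suc (n ℕ.* 2)) i)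
          ≈⟨ T-monomial-step (suc (n ℕ.* 2)) i ⟩
        (1# - q ^ (3 ℕ.+ n ℕ.* 2)) * (h (3 ℕ.+ n ℕ.* 2) * monomial (3 ℕ.+ n ℕ.* 2) i) ∎)

  ∑-swap : ∀ m n (f : ℕ → ℕ → Carrier) → ∑ m (λ i → ∑ n (f i)) ≈ ∑ n (λ j → ∑ m (λ i → f i j))
  ∑-swap m n f = ∑-comm {m} {n} (λ i j → f (toℕ i) (toℕ j))

  inverse-of-product : ∀ {x y z w} → x * y ≈ 1# → x * z * w ≈ 1# → z * w ≈ y
  inverse-of-product {x} {y} {z} {w} xy≈1 xzw≈1 = begin
    z * w                ≈⟨ *-identityˡ _ ⟨
    1# * (z * w)         ≈⟨ *-congʳ xy≈1 ⟨
    x * y * (z * w)      ≈⟨ solve 4 (λ x y z w → x :* y :* (z :* w) := y :* (x :* z :* w)) refl x y z w ⟩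
    y * (x * z * w)      ≈⟨ *-congˡ xzw≈1 ⟩
    y * 1#               ≈⟨ *-identityʳ y ⟩
    y                    ∎

  cancel-inverse : ∀ {x y} z → x * y ≈ 1# → x * z * y ≈ z
  cancel-inverse {x} {y} z xy≈1 = begin
    x * z * y      ≈⟨ solve 3 (λ x y z → x :* z :* y := x :* y :* z) refl x y z ⟩
    x * y * z      ≈⟨ *-congʳ xy≈1 ⟩
    1# * z         ≈⟨ *-identityˡ z ⟩
    z              ∎

  ^-exponents : ∀ x {l} m n → m ℕ.+ n ≡ l → x ^ m * x ^ n ≈ x ^ l
  ^-exponents x m n eq = trans (sym (^-homo-* x m n)) (^-congʳ x eq)

  -- The terms b k: telescoping and theta exponents

  module Telescoping (q : Carrier) (f : ℕ → Carrier) (f₀≈1 : f 0 ≈ 1#) where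

    telescopingTerm : ℕ → Carrier
    telescopingTerm k = q ^ (k ℕ.* k ℕ.+ k) * ((1# - q ^ suc (k ℕ.* 2)) * f (k ℕ.* 2))

    -- The summand L*₂ₖ(1, -u, q) q^(k² + k), with u absorbed into the exponent: (k + 1)² + (k + 1)
    -- - 1 = k² + 3k + 1. Without u it makes sense for power series.
    lucasTerm : ℕ → Carrier
    lucasTerm zero    = 1#
    lucasTerm (suc k) = q ^ (suc k ℕ.* suc k ℕ.+ suc k) * f (2 ℕ.+ k ℕ.* 2) - q ^ (k ℕ.* k ℕ.+ k ℕ.* 3 ℕ.+ 1) * f (k ℕ.* 2)

    -- As k² + 3k + 1 = (k² + k) + (2k + 1), the positive part of term k and the negative part of
    -- term k + 1 combine to b k. For k = 0 the positive part is L*₀ = 1 = f 0, and the last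
    -- positive part is left over.
    ∑-lucasTerm : ∀ n → ∑ (suc n) lucasTerm ≈ ∑ n telescopingTerm + q ^ (n ℕ.* n ℕ.+ n) * f (n ℕ.* 2)
    ∑-lucasTerm zero    = trans (+-identityʳ 1#) (sym (trans (+-identityˡ _) (trans (*-identityˡ _) f₀≈1)))
    ∑-lucasTerm (suc n) = begin
      ∑ (2 ℕ.+ n) lucasTerm
        ≈⟨ ∑-last (suc n) lucasTerm ⟩
      ∑ (suc n) lucasTerm + (b - q ^ (n ℕ.* n ℕ.+ n ℕ.* 3 ℕ.+ 1) * F)
        ≈⟨ +-cong (∑-lucasTerm n) (+-congˡ (-‿cong (*-congʳ (sym (^-exponents q (n ℕ.* n ℕ.+ n) (suc (n ℕ.* 2)) exponent))))) ⟩
      ∑ n telescopingTerm + a * F + (b - a * q ^ suc (n ℕ.* 2) * F)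
        ≈⟨ solve 5 (λ s a b w F → s :+ a :* F :+ (b :- a :* w :* F) := s :+ a :* ((𝟙 :- w) :* F) :+ b) refl (∑ n telescopingTerm) a b (q ^ suc (n ℕ.* 2)) F ⟩
      ∑ n telescopingTerm + telescopingTerm n + b
        ≈⟨ +-congʳ (∑-last n telescopingTerm) ⟨
      ∑ (suc n) telescopingTerm + b ∎
      where
      a = q ^ (n ℕ.* n ℕ.+ n)
      b = q ^ (suc n ℕ.* suc n ℕ.+ suc n) * f (2 ℕ.+ n ℕ.* 2)
      F = f (n ℕ.* 2)
      exponent : n ℕ.* n ℕ.+ n ℕ.+ suc (n ℕ.* 2) ≡ n ℕ.* n ℕ.+ n ℕ.* 3 ℕ.+ 1
      exponent = ℕ-Solver.solve 1 (λ n → n ⊗ n ⊕ n ⊕ (:con 1 ⊕ n ⊗ :con 2) ≔ n ⊗ n ⊕ n ⊗ :con 3 ⊕ :con 1) ≡.refl n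

    module ThetaTerms (f₁≈1 : f 1 ≈ 1#) (f₂≈0 : f 2 ≈ 0#) (f₊₃ : ∀ n → f (3 ℕ.+ n) ≈ - (q ^ suc n * f n)) where

      f₊₆ : ∀ n → f (6 ℕ.+ n) ≈ q ^ (2 ℕ.* n ℕ.+ 5) * f n
      f₊₆ n = begin
        f (6 ℕ.+ n)                                 ≈⟨ trans (f₊₃ (3 ℕ.+ n)) (-‿cong (*-congˡ (f₊₃ n))) ⟩
        - (q ^ (4 ℕ.+ n) * - (q ^ suc n * f n))     ≈⟨ solve 3 (λ a b c → :- (a :* :- (b :* c)) := a :* b :* c) refl (q ^ (4 ℕ.+ n)) (q ^ suc n) (f n) ⟩
        q ^ (4 ℕ.+ n) * q ^ suc n * f n             ≈⟨ *-congʳ (^-exponents q (4 ℕ.+ n) (suc n) exponent) ⟩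
        q ^ (2 ℕ.* n ℕ.+ 5) * f n                   ∎
        where
        exponent : 4 ℕ.+ n ℕ.+ suc n ≡ 2 ℕ.* n ℕ.+ 5
        exponent = ℕ-Solver.solve 1 (λ n → :con 4 ⊕ n ⊕ (:con 1 ⊕ n) ≔ :con 2 ⊗ n ⊕ :con 5) ≡.refl n

      -- f (6 m) = q ^ (6 m² - m) without the subtraction
      f-6m : ∀ m → q ^ m * f (m ℕ.* 3 ℕ.* 2) ≈ q ^ (6 ℕ.* m ℕ.* m)
      f-6m zero    = trans (*-identityˡ _) f₀≈1
      f-6m (suc m) = begin
        q ^ suc m * f (6 ℕ.+ n)                             ≈⟨ *-congˡ (f₊₆ n) ⟩
        q * q ^ m * (q ^ (2 ℕ.* n ℕ.+ 5) * f n)             ≈⟨ solve 4 (λ a b c d → a :* b :* (c :* d) := a :* c :* (b :* d)) refl q (q ^ m) (q ^ (2 ℕ.* n ℕ.+ 5)) (f n) ⟩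
        q ^ suc (2 ℕ.* n ℕ.+ 5) * (q ^ m * f n)             ≈⟨ *-congˡ (f-6m m) ⟩
        q ^ suc (2 ℕ.* n ℕ.+ 5) * q ^ (6 ℕ.* m ℕ.* m)       ≈⟨ ^-exponents q (suc (2 ℕ.* n ℕ.+ 5)) (6 ℕ.* m ℕ.* m) exponent ⟩
        q ^ (6 ℕ.* suc m ℕ.* suc m)                         ∎
        where
        n = m ℕ.* 3 ℕ.* 2
        exponent : suc (2 ℕ.* n ℕ.+ 5) ℕ.+ 6 ℕ.* m ℕ.* m ≡ 6 ℕ.* suc m ℕ.* suc m
        exponent = ℕ-Solver.solve 1 (λ m → :con 1 ⊕ (:con 2 ⊗ (m ⊗ :con 3 ⊗ :con 2) ⊕ :con 5) ⊕ :con 6 ⊗ m ⊗ m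
                                      ≔ :con 6 ⊗ (:con 1 ⊕ m) ⊗ (:con 1 ⊕ m)) ≡.refl m

      f-6m+1 : ∀ m → f (suc (m ℕ.* 3 ℕ.* 2)) ≈ q ^ (6 ℕ.* m ℕ.* m ℕ.+ m)
      f-6m+1 zero    = f₁≈1
      f-6m+1 (suc m) = begin
        f (6 ℕ.+ suc n)                                       ≈⟨ f₊₆ (suc n) ⟩
        q ^ (2 ℕ.* suc n ℕ.+ 5) * f (suc n)                   ≈⟨ *-congˡ (f-6m+1 m) ⟩
        q ^ (2 ℕ.* suc n ℕ.+ 5) * q ^ (6 ℕ.* m ℕ.* m ℕ.+ m)   ≈⟨ ^-exponents q (2 ℕ.* suc n ℕ.+ 5) (6 ℕ.* m ℕ.* m ℕ.+ m) exponent ⟩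
        q ^ (6 ℕ.* suc m ℕ.* suc m ℕ.+ suc m)                 ∎
        where
        n = m ℕ.* 3 ℕ.* 2
        exponent : 2 ℕ.* suc n ℕ.+ 5 ℕ.+ (6 ℕ.* m ℕ.* m ℕ.+ m) ≡ 6 ℕ.* suc m ℕ.* suc m ℕ.+ suc m
        exponent = ℕ-Solver.solve 1 (λ m → :con 2 ⊗ (:con 1 ⊕ (m ⊗ :con 3 ⊗ :con 2)) ⊕ :con 5 ⊕ (:con 6 ⊗ m ⊗ m ⊕ m)
                                      ≔ :con 6 ⊗ (:con 1 ⊕ m) ⊗ (:con 1 ⊕ m) ⊕ (:con 1 ⊕ m)) ≡.refl m

      f-6m+2 : ∀ m → f (2 ℕ.+ m ℕ.* 3 ℕ.* 2) ≈ 0#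
      f-6m+2 zero    = f₂≈0
      f-6m+2 (suc m) = trans (f₊₆ (2 ℕ.+ m ℕ.* 3 ℕ.* 2)) (trans (*-congˡ (f-6m+2 m)) (zeroʳ _))

      telescopingTerm-3m : ∀ m → telescopingTerm (m ℕ.* 3)
        ≈ q ^ (15 ℕ.* m ℕ.* m ℕ.+ 2 ℕ.* m) - q ^ (15 ℕ.* m ℕ.* m ℕ.+ 8 ℕ.* m ℕ.+ 1)
      telescopingTerm-3m m = begin
        q ^ (k ℕ.* k ℕ.+ k) * ((1# - w) * F)
          ≈⟨ *-congʳ (^-exponents q (9 ℕ.* m ℕ.* m ℕ.+ 2 ℕ.* m) m exponent₁) ⟨
        q ^ (9 ℕ.* m ℕ.* m ℕ.+ 2 ℕ.* m) * q ^ m * ((1# - w) * F)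
          ≈⟨ solve 4 (λ a b w F → a :* b :* ((𝟙 :- w) :* F) := a :* (b :* F) :- a :* (b :* F) :* w) refl (q ^ (9 ℕ.* m ℕ.* m ℕ.+ 2 ℕ.* m)) (q ^ m) w F ⟩
        q ^ (9 ℕ.* m ℕ.* m ℕ.+ 2 ℕ.* m) * (q ^ m * F) - q ^ (9 ℕ.* m ℕ.* m ℕ.+ 2 ℕ.* m) * (q ^ m * F) * w
          ≈⟨ +-cong eq (-‿cong (trans (*-congʳ eq) (^-exponents q (15 ℕ.* m ℕ.* m ℕ.+ 2 ℕ.* m) (suc (k ℕ.* 2)) exponent₃))) ⟩
        q ^ (15 ℕ.* m ℕ.* m ℕ.+ 2 ℕ.* m) - q ^ (15 ℕ.* m ℕ.* m ℕ.+ 8 ℕ.* m ℕ.+ 1) ∎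
        where
        k = m ℕ.* 3
        w = q ^ suc (k ℕ.* 2)
        F = f (k ℕ.* 2)
        exponent₁ : 9 ℕ.* m ℕ.* m ℕ.+ 2 ℕ.* m ℕ.+ m ≡ k ℕ.* k ℕ.+ k
        exponent₁ = ℕ-Solver.solve 1 (λ m → :con 9 ⊗ m ⊗ m ⊕ :con 2 ⊗ m ⊕ m ≔ m ⊗ :con 3 ⊗ (m ⊗ :con 3) ⊕ m ⊗ :con 3) ≡.refl m
        exponent₂ : 9 ℕ.* m ℕ.* m ℕ.+ 2 ℕ.* m ℕ.+ 6 ℕ.* m ℕ.* m ≡ 15 ℕ.* m ℕ.* m ℕ.+ 2 ℕ.* m
        exponent₂ = ℕ-Solver.solve 1 (λ m → :con 9 ⊗ m ⊗ m ⊕ :con 2 ⊗ m ⊕ :con 6 ⊗ m ⊗ m ≔ :con 15 ⊗ m ⊗ m ⊕ :con 2 ⊗ m) ≡.refl m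
        exponent₃ : 15 ℕ.* m ℕ.* m ℕ.+ 2 ℕ.* m ℕ.+ suc (k ℕ.* 2) ≡ 15 ℕ.* m ℕ.* m ℕ.+ 8 ℕ.* m ℕ.+ 1
        exponent₃ = ℕ-Solver.solve 1 (λ m → :con 15 ⊗ m ⊗ m ⊕ :con 2 ⊗ m ⊕ (:con 1 ⊕ m ⊗ :con 3 ⊗ :con 2)
                                       ≔ :con 15 ⊗ m ⊗ m ⊕ :con 8 ⊗ m ⊕ :con 1) ≡.refl m
        eq : q ^ (9 ℕ.* m ℕ.* m ℕ.+ 2 ℕ.* m) * (q ^ m * F) ≈ q ^ (15 ℕ.* m ℕ.* m ℕ.+ 2 ℕ.* m)
        eq = trans (*-congˡ (f-6m m)) (^-exponents q (9 ℕ.* m ℕ.* m ℕ.+ 2 ℕ.* m) (6 ℕ.* m ℕ.* m) exponent₂)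

      telescopingTerm-3m+1 : ∀ m → telescopingTerm (suc (m ℕ.* 3)) ≈ 0#
      telescopingTerm-3m+1 m = trans (*-congˡ (trans (*-congˡ (f-6m+2 m)) (zeroʳ _))) (zeroʳ _)

      -- Here 2k = 6m + 4, one application of `f₊₃` beyond 6m + 1. Its minus sign makes the smaller
      -- power the subtracted one, as in the theta summand at a negative index.
      telescopingTerm-3m+2 : ∀ m → telescopingTerm (2 ℕ.+ m ℕ.* 3)
        ≈ q ^ (15 ℕ.* m ℕ.* m ℕ.+ 28 ℕ.* m ℕ.+ 13) - q ^ (15 ℕ.* m ℕ.* m ℕ.+ 22 ℕ.* m ℕ.+ 8)
      telescopingTerm-3m+2 m = begin
        a * ((1# - w) * f (4 ℕ.+ n))
          ≈⟨ *-congˡ (*-congˡ (trans (f₊₃ (suc n)) (-‿cong (*-congˡ (f-6m+1 m))))) ⟩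
        a * ((1# - w) * - (q ^ (2 ℕ.+ n) * q ^ (6 ℕ.* m ℕ.* m ℕ.+ m)))
          ≈⟨ solve 4 (λ a w b c → a :* ((𝟙 :- w) :* :- (b :* c)) := a :* (b :* c) :* w :- a :* (b :* c)) refl a w (q ^ (2 ℕ.+ n)) (q ^ (6 ℕ.* m ℕ.* m ℕ.+ m)) ⟩
        a * (q ^ (2 ℕ.+ n) * q ^ (6 ℕ.* m ℕ.* m ℕ.+ m)) * w - a * (q ^ (2 ℕ.+ n) * q ^ (6 ℕ.* m ℕ.* m ℕ.+ m))
          ≈⟨ +-cong (trans (*-congʳ eq) (^-exponents q (15 ℕ.* m ℕ.* m ℕ.+ 22 ℕ.* m ℕ.+ 8) (suc (k ℕ.* 2)) exponent₂)) (-‿cong eq) ⟩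
        q ^ (15 ℕ.* m ℕ.* m ℕ.+ 28 ℕ.* m ℕ.+ 13) - q ^ (15 ℕ.* m ℕ.* m ℕ.+ 22 ℕ.* m ℕ.+ 8) ∎
        where
        k = 2 ℕ.+ m ℕ.* 3
        n = m ℕ.* 3 ℕ.* 2
        w = q ^ suc (k ℕ.* 2)
        a = q ^ (k ℕ.* k ℕ.+ k)
        exponent₁ : k ℕ.* k ℕ.+ k ℕ.+ (2 ℕ.+ n ℕ.+ (6 ℕ.* m ℕ.* m ℕ.+ m)) ≡ 15 ℕ.* m ℕ.* m ℕ.+ 22 ℕ.* m ℕ.+ 8
        exponent₁ = ℕ-Solver.solve 1 (λ m →
          (:con 2 ⊕ m ⊗ :con 3) ⊗ (:con 2 ⊕ m ⊗ :con 3) ⊕ (:con 2 ⊕ m ⊗ :con 3)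
            ⊕ (:con 2 ⊕ m ⊗ :con 3 ⊗ :con 2 ⊕ (:con 6 ⊗ m ⊗ m ⊕ m))
          ≔ :con 15 ⊗ m ⊗ m ⊕ :con 22 ⊗ m ⊕ :con 8) ≡.refl m
        exponent₂ : 15 ℕ.* m ℕ.* m ℕ.+ 22 ℕ.* m ℕ.+ 8 ℕ.+ suc (k ℕ.* 2) ≡ 15 ℕ.* m ℕ.* m ℕ.+ 28 ℕ.* m ℕ.+ 13
        exponent₂ = ℕ-Solver.solve 1 (λ m →
          :con 15 ⊗ m ⊗ m ⊕ :con 22 ⊗ m ⊕ :con 8 ⊕ (:con 1 ⊕ (:con 2 ⊕ m ⊗ :con 3) ⊗ :con 2)
          ≔ :con 15 ⊗ m ⊗ m ⊕ :con 28 ⊗ m ⊕ :con 13) ≡.refl m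
        eq : a * (q ^ (2 ℕ.+ n) * q ^ (6 ℕ.* m ℕ.* m ℕ.+ m)) ≈ q ^ (15 ℕ.* m ℕ.* m ℕ.+ 22 ℕ.* m ℕ.+ 8)
        eq = trans (*-congˡ (sym (^-homo-* q (2 ℕ.+ n) (6 ℕ.* m ℕ.* m ℕ.+ m)))) (^-exponents q (k ℕ.* k ℕ.+ k) (2 ℕ.+ n ℕ.+ (6 ℕ.* m ℕ.* m ℕ.+ m)) exponent₁)

      ∑-telescopingTerm : ∀ n →
        ∑ n (λ m → telescopingTerm (2 ℕ.+ m ℕ.* 3)) + ∑ n (λ m → telescopingTerm (m ℕ.* 3)) ≈ ∑ (n ℕ.* 3) telescopingTerm
      ∑-telescopingTerm zero    = +-identityˡ 0#
      ∑-telescopingTerm (suc n) = begin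
        ∑ (suc n) c + ∑ (suc n) d
          ≈⟨ +-cong (∑-last n c) (∑-last n d) ⟩
        ∑ n c + c n + (∑ n d + d n)
          ≈⟨ solve 4 (λ a b c d → a :+ c :+ (b :+ d) := a :+ b :+ d :+ c) refl (∑ n c) (∑ n d) (c n) (d n) ⟩
        ∑ n c + ∑ n d + d n + c n
          ≈⟨ +-congʳ (+-congʳ (∑-telescopingTerm n)) ⟩
        ∑ (n ℕ.* 3) t + d n + c n
          ≈⟨ +-congʳ (trans (+-congˡ (telescopingTerm-3m+1 n)) (+-identityʳ _)) ⟨
        ∑ (n ℕ.* 3) t + d n + t (suc (n ℕ.* 3)) + c n
          ≈⟨ +-congʳ (+-congʳ (∑-last (n ℕ.* 3) t)) ⟨
        ∑ (1 ℕ.+ n ℕ.* 3) t + t (suc (n ℕ.* 3)) + c n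
          ≈⟨ +-congʳ (∑-last (1 ℕ.+ n ℕ.* 3) t) ⟨
        ∑ (2 ℕ.+ n ℕ.* 3) t + c n
          ≈⟨ ∑-last (2 ℕ.+ n ℕ.* 3) t ⟨
        ∑ (3 ℕ.+ n ℕ.* 3) t ∎
        where
        t c d : ℕ → Carrier
        t = telescopingTerm
        c m = t (2 ℕ.+ m ℕ.* 3)
        d m = t (m ℕ.* 3)

  -- The double sum behind the first series

  module Interchange (q : Carrier) (h : ℕ → Carrier) (h-zero : h 0 ≈ 1#) (h-suc : ∀ n → (1# - q ^ suc n) * h (suc n) ≈ h n)
                     (f : ℕ → Carrier) (f₀≈1 : f 0 ≈ 1#) where

    open ReciprocalFactorials q h h-zero h-suc
    open Telescoping q f f₀≈1

    h⁻-+ : ∀ k j → h⁻ (k ℕ.+ j) k ≈ h j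
    h⁻-+ zero    j = refl
    h⁻-+ (suc k) j = h⁻-+ k j

    -- The terms with n < k vanish. Putting n = k + i turns n² + n into (k² + k) + i² + i (2k + 1),
    -- and h (n + k + 1) into h (i + 2k + 1): a Durfee sum with m = 2k + 1.
    inner-sum : ∀ k j → ∑ (k ℕ.+ j) (λ n → q ^ (n ℕ.* n ℕ.+ n) * (h⁻ n k * h (suc (n ℕ.+ k))))
      ≈ q ^ (k ℕ.* k ℕ.+ k) * ∑ j (durfeeTerm (suc (k ℕ.* 2)))
    inner-sum k j = begin
      ∑ (k ℕ.+ j) t
        ≈⟨ ∑-split k j t ⟩
      ∑ k t + ∑ j (λ i → t (k ℕ.+ i))
        ≈⟨ +-cong (trans (∑-cong-< k {t} (λ n n<k → trans (*-congˡ (trans (*-congʳ (h⁻-zero n<k)) (zeroˡ _))) (zeroʳ _))) (∑-zero k)) (∑-cong j shifted) ⟩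
      0# + ∑ j (λ i → q ^ (k ℕ.* k ℕ.+ k) * durfeeTerm (suc (k ℕ.* 2)) i)
        ≈⟨ trans (+-identityˡ _) (sym (∑-*ˡ j _ (durfeeTerm (suc (k ℕ.* 2))))) ⟩
      q ^ (k ℕ.* k ℕ.+ k) * ∑ j (durfeeTerm (suc (k ℕ.* 2))) ∎
      where
      t : ℕ → Carrier
      t n = q ^ (n ℕ.* n ℕ.+ n) * (h⁻ n k * h (suc (n ℕ.+ k)))
      shifted : ∀ i → t (k ℕ.+ i) ≈ q ^ (k ℕ.* k ℕ.+ k) * durfeeTerm (suc (k ℕ.* 2)) i
      shifted i = begin
        q ^ ((k ℕ.+ i) ℕ.* (k ℕ.+ i) ℕ.+ (k ℕ.+ i)) * (h⁻ (k ℕ.+ i) k * h (suc (k ℕ.+ i ℕ.+ k)))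
          ≈⟨ *-cong (sym (^-exponents q (k ℕ.* k ℕ.+ k) (i ℕ.* i ℕ.+ i ℕ.* suc (k ℕ.* 2)) exponent)) (*-cong (h⁻-+ k i) (reflexive (≡.cong h index))) ⟩
        q ^ (k ℕ.* k ℕ.+ k) * q ^ (i ℕ.* i ℕ.+ i ℕ.* suc (k ℕ.* 2)) * (h i * h (i ℕ.+ suc (k ℕ.* 2)))
          ≈⟨ *-assoc _ _ _ ⟩
        q ^ (k ℕ.* k ℕ.+ k) * durfeeTerm (suc (k ℕ.* 2)) i ∎
        where
        exponent : k ℕ.* k ℕ.+ k ℕ.+ (i ℕ.* i ℕ.+ i ℕ.* suc (k ℕ.* 2)) ≡ (k ℕ.+ i) ℕ.* (k ℕ.+ i) ℕ.+ (k ℕ.+ i)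
        exponent = ℕ-Solver.solve 2 (λ k i → k ⊗ k ⊕ k ⊕ (i ⊗ i ⊕ i ⊗ (:con 1 ⊕ k ⊗ :con 2)) ≔ (k ⊕ i) ⊗ (k ⊕ i) ⊕ (k ⊕ i)) ≡.refl k i
        index : suc (k ℕ.+ i ℕ.+ k) ≡ i ℕ.+ suc (k ℕ.* 2)
        index = ℕ-Solver.solve 2 (λ k i → :con 1 ⊕ (k ⊕ i ⊕ k) ≔ i ⊕ (:con 1 ⊕ k ⊗ :con 2)) ≡.refl k i

    interchange : (∀ {M} n → n ℕ.< M → ∑ M (λ k → h⁻ n k * h (suc (n ℕ.+ k)) * (1# - q ^ suc (k ℕ.* 2)) * f (k ℕ.* 2)) ≈ h (n ℕ.* 2)) →
      ∀ N → ∑ N (λ n → q ^ (n ℕ.* n ℕ.+ n) * h (n ℕ.* 2)) ≈ ∑ N (λ k → telescopingTerm k * ∑ (N ∸ k) (durfeeTerm (suc (k ℕ.* 2))))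
    interchange expansion N = begin
      ∑ N (λ n → q ^ (n ℕ.* n ℕ.+ n) * h (n ℕ.* 2))
        ≈⟨ ∑-cong-< N (λ n n<N → trans (*-congˡ (sym (expansion n n<N))) (∑-*ˡ N (q ^ (n ℕ.* n ℕ.+ n)) (e n))) ⟩
      ∑ N (λ n → ∑ N (λ k → q ^ (n ℕ.* n ℕ.+ n) * e n k))
        ≈⟨ ∑-swap N N (λ n k → q ^ (n ℕ.* n ℕ.+ n) * e n k) ⟩
      ∑ N (λ k → ∑ N (λ n → q ^ (n ℕ.* n ℕ.+ n) * e n k))
        ≈⟨ ∑-cong-< N column ⟩
      ∑ N (λ k → telescopingTerm k * ∑ (N ∸ k) (durfeeTerm (suc (k ℕ.* 2)))) ∎
      where
      e t : ℕ → ℕ → Carrier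
      e n k = h⁻ n k * h (suc (n ℕ.+ k)) * (1# - q ^ suc (k ℕ.* 2)) * f (k ℕ.* 2)
      t k n = q ^ (n ℕ.* n ℕ.+ n) * (h⁻ n k * h (suc (n ℕ.+ k)))
      column : ∀ k → k ℕ.< N → ∑ N (λ n → q ^ (n ℕ.* n ℕ.+ n) * e n k) ≈ telescopingTerm k * ∑ (N ∸ k) (durfeeTerm (suc (k ℕ.* 2)))
      column k k<N = begin
        ∑ N (λ n → q ^ (n ℕ.* n ℕ.+ n) * e n k)
          ≈⟨ ∑-cong N (λ n → solve 5 (λ a b c d w → a :* (b :* c :* d :* w) := d :* w :* (a :* (b :* c)))
               refl (q ^ (n ℕ.* n ℕ.+ n)) (h⁻ n k) (h (suc (n ℕ.+ k))) (1# - q ^ suc (k ℕ.* 2)) (f (k ℕ.* 2))) ⟩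
        ∑ N (λ n → (1# - q ^ suc (k ℕ.* 2)) * f (k ℕ.* 2) * t k n)
          ≈⟨ ∑-*ˡ N _ (t k) ⟨
        (1# - q ^ suc (k ℕ.* 2)) * f (k ℕ.* 2) * ∑ N (t k)
          ≈⟨ *-congˡ (reflexive (≡.cong (λ n → ∑ n (t k)) (ℕ.m+[n∸m]≡n (ℕ.<⇒≤ k<N)))) ⟨
        (1# - q ^ suc (k ℕ.* 2)) * f (k ℕ.* 2) * ∑ (k ℕ.+ (N ∸ k)) (t k)
          ≈⟨ *-congˡ (inner-sum k (N ∸ k)) ⟩
        (1# - q ^ suc (k ℕ.* 2)) * f (k ℕ.* 2) * (q ^ (k ℕ.* k ℕ.+ k) * s)
          ≈⟨ solve 3 (λ g a s → g :* (a :* s) := a :* g :* s) refl _ (q ^ (k ℕ.* k ℕ.+ k)) s ⟩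
        telescopingTerm k * s ∎
        where s = ∑ (N ∸ k) (durfeeTerm (suc (k ℕ.* 2)))

open import Defs
open ≡ using (refl; cong; cong₂; module ≡-Reasoning)

-- The rings of power series and of Laurent series

private module Σℤ = SemiringSum ℤ.+-*-semiring
module ℤ-Solver = ℤ.+-*-Solver

infixl 7 _∙_
_∙_ : ℤ → ℤ⟦q⟧ → ℤ⟦q⟧
(z ∙ a) n = z ℤ.* a n

const : ℤ → ℤ⟦q⟧
const z zero    = z
const z (suc _) = 0ℤ

tail : ℤ⟦q⟧ → ℤ⟦q⟧
tail a = a ∘ suc

*ˢ-cong : ∀ {a a′ b b′} → a ≗ a′ → b ≗ b′ → a *ˢ b ≗ a′ *ˢ b′
*ˢ-cong a≗ b≗ n = Σℤ.sum-cong-≋ {suc n} λ i → cong₂ ℤ._*_ (a≗ (toℕ i)) (b≗ (n ∸ toℕ i))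

-- By computation a product splits off the first coefficient of its left factor. This is the mirror
-- image, from which commutativity follows by induction.
*ˢ-sucʳ : ∀ a b n → (a *ˢ b) (suc n) ≡ a (suc n) ℤ.* b 0 ℤ.+ (a *ˢ tail b) n
*ˢ-sucʳ a b zero    = solve 4 (λ x y z w → x :* y :+ (z :* w :+ con 0ℤ) := z :* w :+ (x :* y :+ con 0ℤ)) refl (a 0) (b 1) (a 1) (b 0)
  where open ℤ-Solver
*ˢ-sucʳ a b (suc n) = begin
  a 0 ℤ.* b (2 ℕ.+ n) ℤ.+ (tail a *ˢ b) (suc n)
    ≡⟨ cong (ℤ._+_ (a 0 ℤ.* b (2 ℕ.+ n))) (*ˢ-sucʳ (tail a) b n) ⟩
  a 0 ℤ.* b (2 ℕ.+ n) ℤ.+ (a (2 ℕ.+ n) ℤ.* b 0 ℤ.+ (tail a *ˢ tail b) n)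
    ≡⟨ solve 3 (λ x y z → x :+ (y :+ z) := y :+ (x :+ z)) refl (a 0 ℤ.* b (2 ℕ.+ n)) (a (2 ℕ.+ n) ℤ.* b 0) ((tail a *ˢ tail b) n) ⟩
  a (2 ℕ.+ n) ℤ.* b 0 ℤ.+ (a 0 ℤ.* b (2 ℕ.+ n) ℤ.+ (tail a *ˢ tail b) n) ∎
  where
  open ≡-Reasoning
  open ℤ-Solver

*ˢ-comm : ∀ a b → a *ˢ b ≗ b *ˢ a
*ˢ-comm a b zero    = cong (ℤ._+ 0ℤ) (ℤ.*-comm (a 0) (b 0))
*ˢ-comm a b (suc n) = ≡.trans (cong₂ ℤ._+_ (ℤ.*-comm (a 0) (b (suc n))) (*ˢ-comm (tail a) b n)) (≡.sym (*ˢ-sucʳ b a n))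

*ˢ-distribʳ : ∀ c a b → (a +ˢ b) *ˢ c ≗ (a *ˢ c) +ˢ (b *ˢ c)
*ˢ-distribʳ c a b zero    = solve 3 (λ x y z → (x :+ y) :* z :+ con 0ℤ := x :* z :+ con 0ℤ :+ (y :* z :+ con 0ℤ)) refl (a 0) (b 0) (c 0)
  where open ℤ-Solver
*ˢ-distribʳ c a b (suc n) = ≡.trans (cong (ℤ._+_ ((a 0 ℤ.+ b 0) ℤ.* c (suc n))) (*ˢ-distribʳ c (tail a) (tail b) n))
  (solve 5 (λ x y z s t → (x :+ y) :* z :+ (s :+ t) := x :* z :+ s :+ (y :* z :+ t)) refl (a 0) (b 0) (c (suc n)) ((tail a *ˢ c) n) ((tail b *ˢ c) n))
  where open ℤ-Solver

∙-*ˢ : ∀ z a b → (z ∙ a) *ˢ b ≗ z ∙ (a *ˢ b)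
∙-*ˢ z a b zero    = solve 3 (λ x y z → x :* y :* z :+ con 0ℤ := x :* (y :* z :+ con 0ℤ)) refl z (a 0) (b 0)
  where open ℤ-Solver
∙-*ˢ z a b (suc n) = ≡.trans (cong (ℤ._+_ (z ℤ.* a 0 ℤ.* b (suc n))) (∙-*ˢ z (tail a) b n))
  (solve 4 (λ x y z w → x :* y :* z :+ x :* w := x :* (y :* z :+ w)) refl z (a 0) (b (suc n)) ((tail a *ˢ b) n))
  where open ℤ-Solver

-- Induction on the exponent: `tail (a *ˢ b)` is by computation `(a 0 ∙ tail b) +ˢ (tail a *ˢ b)`,
-- so distributivity and scalars reduce the claim to `tail a`.
*ˢ-assoc : ∀ a b c → (a *ˢ b) *ˢ c ≗ a *ˢ (b *ˢ c)
*ˢ-assoc a b c zero    = solve 3 (λ x y z → (x :* y :+ con 0ℤ) :* z :+ con 0ℤ := x :* (y :* z :+ con 0ℤ) :+ con 0ℤ) refl (a 0) (b 0) (c 0)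
  where open ℤ-Solver
*ˢ-assoc a b c (suc n) = begin
  (a 0 ℤ.* b 0 ℤ.+ 0ℤ) ℤ.* c (suc n) ℤ.+ (((a 0 ∙ tail b) +ˢ (tail a *ˢ b)) *ˢ c) n
    ≡⟨ cong (ℤ._+_ ((a 0 ℤ.* b 0 ℤ.+ 0ℤ) ℤ.* c (suc n))) (*ˢ-distribʳ c (a 0 ∙ tail b) (tail a *ˢ b) n) ⟩
  (a 0 ℤ.* b 0 ℤ.+ 0ℤ) ℤ.* c (suc n) ℤ.+ (((a 0 ∙ tail b) *ˢ c) n ℤ.+ ((tail a *ˢ b) *ˢ c) n)
    ≡⟨ cong (ℤ._+_ ((a 0 ℤ.* b 0 ℤ.+ 0ℤ) ℤ.* c (suc n))) (cong₂ ℤ._+_ (∙-*ˢ (a 0) (tail b) c n) (*ˢ-assoc (tail a) b c n)) ⟩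
  (a 0 ℤ.* b 0 ℤ.+ 0ℤ) ℤ.* c (suc n) ℤ.+ (a 0 ℤ.* (tail b *ˢ c) n ℤ.+ (tail a *ˢ (b *ˢ c)) n)
    ≡⟨ solve 5 (λ x y z v w → (x :* y :+ con 0ℤ) :* z :+ (x :* v :+ w) := x :* (y :* z :+ v) :+ w) refl (a 0) (b 0) (c (suc n)) ((tail b *ˢ c) n) ((tail a *ˢ (b *ˢ c)) n) ⟩
  a 0 ℤ.* (b 0 ℤ.* c (suc n) ℤ.+ (tail b *ˢ c) n) ℤ.+ (tail a *ˢ (b *ˢ c)) n ∎
  where
  open ≡-Reasoning
  open ℤ-Solver

0ˢ-*ˢ : ∀ a → 0ˢ *ˢ a ≗ 0ˢ
0ˢ-*ˢ a n = Σℤ.sum-replicate-zero (suc n)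

const-*ˢ : ∀ z a → const z *ˢ a ≗ z ∙ a
const-*ˢ z a zero    = ℤ.+-identityʳ _
const-*ˢ z a (suc n) = ≡.trans (cong (ℤ._+_ (z ℤ.* a (suc n))) (0ˢ-*ˢ a n)) (ℤ.+-identityʳ _)

1ˢ≗const : 1ˢ ≗ const 1ℤ
1ˢ≗const zero    = refl
1ˢ≗const (suc n) = refl

*ˢ-identityˡ : ∀ a → 1ˢ *ˢ a ≗ a
*ˢ-identityˡ a n = ≡.trans (*ˢ-cong {b = a} 1ˢ≗const (λ _ → refl) n) (≡.trans (const-*ˢ 1ℤ a n) (ℤ.*-identityˡ (a n)))

seriesRing : CommutativeRing 0ℓ 0ℓ
seriesRing = record
  { Carrier = ℤ⟦q⟧ ; _≈_ = _≗_ ; _+_ = _+ˢ_ ; _*_ = _*ˢ_ ; -_ = -ˢ_ ; 0# = 0ˢ ; 1# = 1ˢ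
  ; isCommutativeRing = record
    { isRing = record
      { +-isAbelianGroup = record
        { isGroup = record
          { isMonoid = record
            { isSemigroup = record
              { isMagma = record
                { isEquivalence = record
                  { refl  = λ _ → refl
                  ; sym   = λ e n → ≡.sym (e n)
                  ; trans = λ d e n → ≡.trans (d n) (e n)
                  }
                ; ∙-cong = λ d e n → cong₂ ℤ._+_ (d n) (e n)
                }
              ; assoc = λ a b c n → ℤ.+-assoc (a n) (b n) (c n)
              }
            ; identity = (λ a n → ℤ.+-identityˡ (a n)) , (λ a n → ℤ.+-identityʳ (a n))
            }
          ; inverse = (λ a n → ℤ.+-inverseˡ (a n)) , (λ a n → ℤ.+-inverseʳ (a n))
          ; ⁻¹-cong = λ d n → cong ℤ.-_ (d n)
          }
        ; comm = λ a b n → ℤ.+-comm (a n) (b n)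
        }
      ; *-cong = *ˢ-cong
      ; *-assoc = *ˢ-assoc
      ; *-identity = *ˢ-identityˡ , λ a n → ≡.trans (*ˢ-comm a 1ˢ n) (*ˢ-identityˡ a n)
      ; distrib = (λ c a b n → ≡.trans (*ˢ-comm c (a +ˢ b) n) (≡.trans (*ˢ-distribʳ c a b n) (cong₂ ℤ._+_ (*ˢ-comm a c n) (*ˢ-comm b c n))))
                , *ˢ-distribʳ
      }
    ; *-comm = *ˢ-comm
    }
  }

constants : ℤ-rawRing -Raw-AlmostCommutative⟶ fromCommutativeRing seriesRing
constants = record
  { ⟦_⟧    = const
  ; +-homo = λ { y z zero → refl ; y z (suc n) → refl }
  ; *-homo = λ y z n → ≡.sym (≡.trans (const-*ˢ y (const z) n) (∙-const y z n))
  ; -‿homo = λ { z zero → refl ; z (suc n) → refl }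
  ; 0-homo = λ { zero → refl ; (suc n) → refl }
  ; 1-homo = λ n → ≡.sym (1ˢ≗const n)
  }
  where
  ∙-const : ∀ y z n → (y ∙ const z) n ≡ const (y ℤ.* z) n
  ∙-const y z zero    = refl
  ∙-const y z (suc n) = ℤ.*-zeroʳ y

private module R = CommutativeRing seriesRing

raise-cong : ∀ m {a b} → a ≗ b → raise m a ≗ raise m b
raise-cong zero    e n       = e n
raise-cong (suc m) e zero    = refl
raise-cong (suc m) e (suc n) = raise-cong m e n

raise-+ˢ : ∀ m a b → raise m (a +ˢ b) ≗ raise m a +ˢ raise m b
raise-+ˢ zero    a b n       = refl
raise-+ˢ (suc m) a b zero    = refl
raise-+ˢ (suc m) a b (suc n) = raise-+ˢ m a b n

raise-raise : ∀ m n a → raise (m ℕ.+ n) a ≗ raise m (raise n a)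
raise-raise zero    n a i       = refl
raise-raise (suc m) n a zero    = refl
raise-raise (suc m) n a (suc i) = raise-raise m n a i

raise-*ˢ : ∀ m a b → raise m a *ˢ b ≗ raise m (a *ˢ b)
raise-*ˢ zero    a b n       = refl
raise-*ˢ (suc m) a b zero    = refl
raise-*ˢ (suc m) a b (suc n) = ≡.trans (ℤ.+-identityˡ _) (raise-*ˢ m a b n)

*ˢ-raise : ∀ n a b → a *ˢ raise n b ≗ raise n (a *ˢ b)
*ˢ-raise n a b = R.trans (*ˢ-comm a (raise n b)) (R.trans (raise-*ˢ n b a) (raise-cong n (*ˢ-comm b a)))

raise-1ˢ : ∀ m a → raise m 1ˢ *ˢ a ≗ raise m a
raise-1ˢ m a = R.trans (raise-*ˢ m 1ˢ a) (raise-cong m (*ˢ-identityˡ a))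

-- The case of `coeff` without pole. Through `coeff-at` later proofs avoid the case analysis inside
-- `coeff`.
_at_ : ℤ⟦q⟧ → ℤ → ℤ
a at (+ n)    = a n
a at -[1+ _ ] = 0ℤ

coeff-at : ∀ m a z → coeff (q^- m · a) z ≡ a at (z ℤ.+ + m)
coeff-at m a z with z ℤ.+ + m
... | + n      = refl
... | -[1+ _ ] = refl

at-cong : ∀ {a b} → a ≗ b → ∀ z → a at z ≡ b at z
at-cong e (+ n)    = e n
at-cong e -[1+ n ] = refl

at-+ˢ : ∀ a b z → (a +ˢ b) at z ≡ a at z ℤ.+ b at z
at-+ˢ a b (+ n)    = refl
at-+ˢ a b -[1+ n ] = refl

at--ˢ : ∀ a z → (-ˢ a) at z ≡ ℤ.- (a at z)
at--ˢ a (+ n)    = refl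
at--ˢ a -[1+ n ] = refl

raise-at : ∀ m a z → raise m a at (z ℤ.+ + m) ≡ a at z
raise-at zero a z = cong (a at_) (ℤ.+-identityʳ z)
raise-at (suc m) a z = begin
  raise (suc m) a at (z ℤ.+ + suc m)      ≡⟨ cong (raise (suc m) a at_) (≡.trans (cong (ℤ._+_ z) (ℤ.+-comm 1ℤ (+ m))) (≡.sym (ℤ.+-assoc z (+ m) 1ℤ))) ⟩
  raise (suc m) a at (z ℤ.+ + m ℤ.+ 1ℤ)   ≡⟨ raise-suc-at (z ℤ.+ + m) ⟩
  raise m a at (z ℤ.+ + m)                ≡⟨ raise-at m a z ⟩
  a at z                                  ∎
  where
  open ≡-Reasoning
  raise-suc-at : ∀ w → raise (suc m) a at (w ℤ.+ 1ℤ) ≡ raise m a at w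
  raise-suc-at (+ n) rewrite ℕ.+-comm n 1 = refl
  raise-suc-at -[1+ zero ]  = refl
  raise-suc-at -[1+ suc n ] = refl

module _ where
  open ≡-Reasoning

  raise-pole : ∀ m n a → (q^- (m ℕ.+ n) · raise n a) ≈ (q^- m · a)
  raise-pole m n a z = begin
    coeff (q^- (m ℕ.+ n) · raise n a) z       ≡⟨ coeff-at (m ℕ.+ n) (raise n a) z ⟩
    raise n a at (z ℤ.+ + (m ℕ.+ n))          ≡⟨ cong (raise n a at_) (≡.sym (ℤ.+-assoc z (+ m) (+ n))) ⟩
    raise n a at (z ℤ.+ + m ℤ.+ + n)          ≡⟨ raise-at n a (z ℤ.+ + m) ⟩
    a at (z ℤ.+ + m)                          ≡⟨ coeff-at m a z ⟨
    coeff (q^- m · a) z                       ∎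

  series-cong : ∀ {m n a b} → m ≡ n → a ≗ b → (q^- m · a) ≈ (q^- n · b)
  series-cong {m} {.m} {a} {b} refl e z = begin
    coeff (q^- m · a) z ≡⟨ coeff-at m a z ⟩
    a at (z ℤ.+ + m)    ≡⟨ at-cong e (z ℤ.+ + m) ⟩
    b at (z ℤ.+ + m)    ≡⟨ coeff-at m b z ⟨
    coeff (q^- m · b) z ∎

  series-injective : ∀ m {a b} → (q^- m · a) ≈ (q^- m · b) → a ≗ b
  series-injective m {a} {b} e n = begin
    a n                          ≡⟨ cong (a at_) (z+m n) ⟨
    a at (+ n ℤ.- + m ℤ.+ + m)   ≡⟨ coeff-at m a (+ n ℤ.- + m) ⟨
    coeff (q^- m · a) (+ n ℤ.- + m)          ≡⟨ e (+ n ℤ.- + m) ⟩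
    coeff (q^- m · b) (+ n ℤ.- + m)          ≡⟨ coeff-at m b (+ n ℤ.- + m) ⟩
    b at (+ n ℤ.- + m ℤ.+ + m)   ≡⟨ cong (b at_) (z+m n) ⟩
    b n                          ∎
    where
    z+m : ∀ n → + n ℤ.- + m ℤ.+ + m ≡ + n
    z+m n = ≡.trans (ℤ.+-assoc (+ n) (ℤ.- (+ m)) (+ m)) (≡.trans (cong (ℤ._+_ (+ n)) (ℤ.+-inverseˡ (+ m))) (ℤ.+-identityʳ (+ n)))

≈-isEquivalence : IsEquivalence _≈_
≈-isEquivalence = record
  { refl  = λ _ → refl
  ; sym   = λ e z → ≡.sym (e z)
  ; trans = λ d e z → ≡.trans (d z) (e z)
  }

laurentSetoid : Setoid 0ℓ 0ℓ
laurentSetoid = record { isEquivalence = ≈-isEquivalence }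

private module ≈ = IsEquivalence ≈-isEquivalence

-- Cross multiplication: q⁻ᵐ a = q⁻ⁿ b gives qⁿ a = qᵐ b, and `raise⇒≈` is the converse.
-- Compatibility of products with `_≈_` thereby becomes a statement about power series.
≈⇒raise : ∀ {m n a b} → (q^- m · a) ≈ (q^- n · b) → raise n a ≗ raise m b
≈⇒raise {m} {n} {a} {b} e = series-injective (m ℕ.+ n)
  (≈.trans (raise-pole m n a) (≈.trans e (≈.trans (≈.sym (raise-pole n m b)) (series-cong (ℕ.+-comm n m) λ _ → refl))))

raise⇒≈ : ∀ {m n a b} → raise n a ≗ raise m b → (q^- m · a) ≈ (q^- n · b)
raise⇒≈ {m} {n} {a} {b} e =
  ≈.trans (≈.sym (raise-pole m n a)) (≈.trans (series-cong (ℕ.+-comm m n) e) (raise-pole n m b))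

-- As `_≈_` compares coefficients, this lemma and `coeff--` carry the additive laws over from ℤ; the
-- multiplicative ones are checked on representatives.
coeff-+ : ∀ f g z → coeff (f + g) z ≡ coeff f z ℤ.+ coeff g z
coeff-+ (q^- m · a) (q^- n · b) z = begin
  coeff ((q^- m · a) + (q^- n · b)) z
    ≡⟨ coeff-at (m ℕ.+ n) _ z ⟩
  (raise n a +ˢ raise m b) at (z ℤ.+ + (m ℕ.+ n))
    ≡⟨ at-+ˢ (raise n a) (raise m b) (z ℤ.+ + (m ℕ.+ n)) ⟩
  raise n a at (z ℤ.+ + (m ℕ.+ n)) ℤ.+ raise m b at (z ℤ.+ + (m ℕ.+ n))
    ≡⟨ cong₂ ℤ._+_ (coeff-at (m ℕ.+ n) (raise n a) z) (coeff-at (m ℕ.+ n) (raise m b) z) ⟨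
  coeff (q^- (m ℕ.+ n) · raise n a) z ℤ.+ coeff (q^- (m ℕ.+ n) · raise m b) z
    ≡⟨ cong₂ ℤ._+_ (raise-pole m n a z) (≡.trans (series-cong (ℕ.+-comm m n) (λ _ → refl) z) (raise-pole n m b z)) ⟩
  coeff (q^- m · a) z ℤ.+ coeff (q^- n · b) z ∎
  where open ≡-Reasoning

coeff-- : ∀ f z → coeff (- f) z ≡ ℤ.- coeff f z
coeff-- (q^- m · a) z = begin
  coeff (- (q^- m · a)) z      ≡⟨ coeff-at m (-ˢ a) z ⟩
  (-ˢ a) at (z ℤ.+ + m)        ≡⟨ at--ˢ a (z ℤ.+ + m) ⟩
  ℤ.- (a at (z ℤ.+ + m))       ≡⟨ cong ℤ.-_ (coeff-at m a z) ⟨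
  ℤ.- coeff (q^- m · a) z      ∎
  where open ≡-Reasoning

coeff-0# : ∀ z → coeff 0# z ≡ 0ℤ
coeff-0# z = ≡.trans (coeff-at 0 0ˢ z) (at-0ˢ (z ℤ.+ 0ℤ))
  where
  at-0ˢ : ∀ z → 0ˢ at z ≡ 0ℤ
  at-0ˢ (+ n)    = refl
  at-0ˢ -[1+ n ] = refl

*-cong : ∀ {f f′ g g′} → f ≈ f′ → g ≈ g′ → f * g ≈ f′ * g′
*-cong {q^- m · a} {q^- m′ · a′} {q^- n · b} {q^- n′ · b′} d e = raise⇒≈ {m ℕ.+ n} {m′ ℕ.+ n′} (begin
  raise (m′ ℕ.+ n′) (a *ˢ b)      ≈⟨ raise-raise m′ n′ (a *ˢ b) ⟩
  raise m′ (raise n′ (a *ˢ b))    ≈⟨ raise-cong m′ (*ˢ-raise n′ a b) ⟨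
  raise m′ (a *ˢ raise n′ b)      ≈⟨ raise-*ˢ m′ a (raise n′ b) ⟨
  raise m′ a *ˢ raise n′ b        ≈⟨ *ˢ-cong (≈⇒raise {m} {m′} d) (≈⇒raise {n} {n′} e) ⟩
  raise m a′ *ˢ raise n b′        ≈⟨ raise-*ˢ m a′ (raise n b′) ⟩
  raise m (a′ *ˢ raise n b′)      ≈⟨ raise-cong m (*ˢ-raise n a′ b′) ⟩
  raise m (raise n (a′ *ˢ b′))    ≈⟨ raise-raise m n (a′ *ˢ b′) ⟨
  raise (m ℕ.+ n) (a′ *ˢ b′)      ∎)
  where open SetoidReasoning R.setoid

*-comm : ∀ f g → f * g ≈ g * f
*-comm (q^- m · a) (q^- n · b) = series-cong (ℕ.+-comm m n) (*ˢ-comm a b)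

*-identityˡ : ∀ f → 1# * f ≈ f
*-identityˡ (q^- m · a) = series-cong refl (*ˢ-identityˡ a)

+-cong : ∀ {f f′ g g′} → f ≈ f′ → g ≈ g′ → f + g ≈ f′ + g′
+-cong {f} {f′} {g} {g′} d e z = ≡.trans (coeff-+ f g z) (≡.trans (cong₂ ℤ._+_ (d z) (e z)) (≡.sym (coeff-+ f′ g′ z)))

same-pole-+ : ∀ m a b → (q^- m · a) + (q^- m · b) ≈ (q^- m · (a +ˢ b))
same-pole-+ m a b = ≈.trans (series-cong refl (R.sym (raise-+ˢ m a b))) (raise-pole m m (a +ˢ b))

*-distribʳ : ∀ f g h → (g + h) * f ≈ g * f + h * f
*-distribʳ (q^- m · a) (q^- n · b) (q^- o · c) = begin
  (q^- (n ℕ.+ o ℕ.+ m) · ((raise o b +ˢ raise n c) *ˢ a))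
    ≈⟨ series-cong refl (*ˢ-distribʳ a (raise o b) (raise n c)) ⟩
  (q^- (n ℕ.+ o ℕ.+ m) · ((raise o b *ˢ a) +ˢ (raise n c *ˢ a)))
    ≈⟨ same-pole-+ (n ℕ.+ o ℕ.+ m) _ _ ⟨
  (q^- (n ℕ.+ o ℕ.+ m) · (raise o b *ˢ a)) + (q^- (n ℕ.+ o ℕ.+ m) · (raise n c *ˢ a))
    ≈⟨ +-cong {f = q^- (n ℕ.+ o ℕ.+ m) · (raise o b *ˢ a)} {q^- (n ℕ.+ m) · (b *ˢ a)}
              {q^- (n ℕ.+ o ℕ.+ m) · (raise n c *ˢ a)} {q^- (o ℕ.+ m) · (c *ˢ a)}
         (≈.trans (series-cong (pole₁ n m o) (raise-*ˢ o b a)) (raise-pole (n ℕ.+ m) o (b *ˢ a)))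
         (≈.trans (series-cong (pole₂ n m o) (raise-*ˢ n c a)) (raise-pole (o ℕ.+ m) n (c *ˢ a))) ⟩
  (q^- (n ℕ.+ m) · (b *ˢ a)) + (q^- (o ℕ.+ m) · (c *ˢ a)) ∎
  where
  open SetoidReasoning laurentSetoid
  pole₁ : ∀ n m o → n ℕ.+ o ℕ.+ m ≡ n ℕ.+ m ℕ.+ o
  pole₁ n m o = ≡.trans (ℕ.+-assoc n o m) (≡.trans (cong (n ℕ.+_) (ℕ.+-comm o m)) (≡.sym (ℕ.+-assoc n m o)))
  pole₂ : ∀ n m o → n ℕ.+ o ℕ.+ m ≡ o ℕ.+ m ℕ.+ n
  pole₂ n m o = ≡.trans (ℕ.+-assoc n o m) (ℕ.+-comm n (o ℕ.+ m))

laurentRing : CommutativeRing 0ℓ 0ℓ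
laurentRing = record
  { Carrier = ℤ⦅q⦆ ; _≈_ = _≈_ ; _+_ = _+_ ; _*_ = _*_ ; -_ = -_ ; 0# = 0# ; 1# = 1#
  ; isCommutativeRing = record
    { isRing = record
      { +-isAbelianGroup = record
        { isGroup = record
          { isMonoid = record
            { isSemigroup = record
              { isMagma = record
                { isEquivalence = ≈-isEquivalence
                ; ∙-cong = λ {f} {f′} {g} {g′} → +-cong {f} {f′} {g} {g′}
                }
              ; assoc = λ f g h z → begin
                  coeff (f + g + h) z                           ≡⟨ coeff-+ (f + g) h z ⟩
                  coeff (f + g) z ℤ.+ coeff h z                 ≡⟨ cong (ℤ._+ coeff h z) (coeff-+ f g z) ⟩
                  coeff f z ℤ.+ coeff g z ℤ.+ coeff h z         ≡⟨ ℤ.+-assoc (coeff f z) (coeff g z) (coeff h z) ⟩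
                  coeff f z ℤ.+ (coeff g z ℤ.+ coeff h z)       ≡⟨ cong (ℤ._+_ (coeff f z)) (coeff-+ g h z) ⟨
                  coeff f z ℤ.+ coeff (g + h) z                 ≡⟨ coeff-+ f (g + h) z ⟨
                  coeff (f + (g + h)) z                         ∎
              }
            ; identity = +-identityˡ , λ f → ≈.trans (+-comm f 0#) (+-identityˡ f)
            }
          ; inverse = -‿inverseˡ , λ f → ≈.trans (+-comm f (- f)) (-‿inverseˡ f)
          ; ⁻¹-cong = λ {f} {g} e z → ≡.trans (coeff-- f z) (≡.trans (cong ℤ.-_ (e z)) (≡.sym (coeff-- g z)))
          }
        ; comm = +-comm
        }
      ; *-cong = λ {f} {f′} {g} {g′} → *-cong {f} {f′} {g} {g′}
      ; *-assoc = λ { (q^- m · a) (q^- n · b) (q^- o · c) → series-cong (ℕ.+-assoc m n o) (*ˢ-assoc a b c) }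
      ; *-identity = *-identityˡ , λ f → ≈.trans (*-comm f 1#) (*-identityˡ f)
      ; distrib = (λ f g h → ≈.trans (*-comm f (g + h)) (≈.trans (*-distribʳ f g h)
                    (+-cong {g * f} {f * g} {h * f} {f * h} (*-comm g f) (*-comm h f))))
                , *-distribʳ
      }
    ; *-comm = *-comm
    }
  }
  where
  open ≡-Reasoning
  +-comm : ∀ f g → f + g ≈ g + f
  +-comm f g z = ≡.trans (coeff-+ f g z) (≡.trans (ℤ.+-comm (coeff f z) (coeff g z)) (≡.sym (coeff-+ g f z)))
  +-identityˡ : ∀ f → 0# + f ≈ f
  +-identityˡ f z = ≡.trans (coeff-+ 0# f z) (≡.trans (cong (ℤ._+ coeff f z) (coeff-0# z)) (ℤ.+-identityˡ (coeff f z)))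
  -‿inverseˡ : ∀ f → - f + f ≈ 0#
  -‿inverseˡ f z = begin
    coeff (- f + f) z                 ≡⟨ coeff-+ (- f) f z ⟩
    coeff (- f) z ℤ.+ coeff f z       ≡⟨ cong (ℤ._+ coeff f z) (coeff-- f z) ⟩
    ℤ.- coeff f z ℤ.+ coeff f z       ≡⟨ ℤ.+-inverseˡ (coeff f z) ⟩
    0ℤ                                ≡⟨ coeff-0# z ⟨
    coeff 0# z                        ∎

ι-cong : ∀ {a b} → a ≗ b → ι a ≈ ι b
ι-cong = series-cong refl

ι-injective : ∀ {a b} → ι a ≈ ι b → a ≗ b
ι-injective = series-injective 0

laurentConstants : ℤ-rawRing -Raw-AlmostCommutative⟶ fromCommutativeRing laurentRing
laurentConstants = record
  { ⟦_⟧    = λ z → ι (const z)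
  ; +-homo = λ y z → ι-cong (C.+-homo y z)
  ; *-homo = λ y z → ι-cong (C.*-homo y z)
  ; -‿homo = λ z → ι-cong (C.-‿homo z)
  ; 0-homo = ι-cong C.0-homo
  ; 1-homo = ι-cong C.1-homo
  }
  where module C = _-Raw-AlmostCommutative⟶_ constants

-- The theta exponents at k = m and k = -m - 1

pos-quadratic : ∀ a b c m → + (a ℕ.* m ℕ.* m ℕ.+ b ℕ.* m ℕ.+ c) ≡ + a ℤ.* + m ℤ.* + m ℤ.+ + b ℤ.* + m ℤ.+ + c
pos-quadratic a b c m = cong (ℤ._+ + c) (cong₂ ℤ._+_ (≡.trans (ℤ.pos-* (a ℕ.* m) m) (cong (ℤ._* + m) (ℤ.pos-* a m))) (ℤ.pos-* b m))

α β : ℤ → ℤ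
α k = + 15 ℤ.* k ℤ.* k ℤ.+ + 2 ℤ.* k
β k = + 15 ℤ.* k ℤ.* k ℤ.+ + 8 ℤ.* k ℤ.+ + 1

α-pos : ∀ m → α (+ m) ≡ + (15 ℕ.* m ℕ.* m ℕ.+ 2 ℕ.* m)
α-pos m = ≡.trans (≡.sym (ℤ.+-identityʳ (α (+ m)))) (≡.trans (≡.sym (pos-quadratic 15 2 0 m)) (cong +_ (ℕ.+-identityʳ (15 ℕ.* m ℕ.* m ℕ.+ 2 ℕ.* m))))

α-neg : ∀ m → α -[1+ m ] ≡ + (15 ℕ.* m ℕ.* m ℕ.+ 28 ℕ.* m ℕ.+ 13)
α-neg m = ≡.trans (expand (+ m)) (≡.sym (pos-quadratic 15 28 13 m))
  where
  open ℤ-Solver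
  expand : ∀ x → α (ℤ.- (1ℤ ℤ.+ x)) ≡ + 15 ℤ.* x ℤ.* x ℤ.+ + 28 ℤ.* x ℤ.+ + 13
  expand = solve 1 (λ x → let k = :- (con 1ℤ :+ x) in
    con (+ 15) :* k :* k :+ con (+ 2) :* k := con (+ 15) :* x :* x :+ con (+ 28) :* x :+ con (+ 13)) refl

β-neg : ∀ m → β -[1+ m ] ≡ + (15 ℕ.* m ℕ.* m ℕ.+ 22 ℕ.* m ℕ.+ 8)
β-neg m = ≡.trans (expand (+ m)) (≡.sym (pos-quadratic 15 22 8 m))
  where
  open ℤ-Solver
  expand : ∀ x → β (ℤ.- (1ℤ ℤ.+ x)) ≡ + 15 ℤ.* x ℤ.* x ℤ.+ + 22 ℤ.* x ℤ.+ + 8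
  expand = solve 1 (λ x → let k = :- (con 1ℤ :+ x) in
    con (+ 15) :* k :* k :+ con (+ 8) :* k :+ con (+ 1) := con (+ 15) :* x :* x :+ con (+ 22) :* x :+ con (+ 8)) refl

module 𝕊 = Ring (wrapRing seriesRing) (wrapConstants seriesRing constants)
module 𝕃 = Ring (wrapRing laurentRing) (wrapConstants laurentRing laurentConstants)

infix 4 _≋ˢ_ _≋_
_≋ˢ_ : ℤ⟦q⟧ → ℤ⟦q⟧ → Set
_≋ˢ_ = 𝕊._≈_

_≋_ : ℤ⦅q⦆ → ℤ⦅q⦆ → Set
_≋_ = 𝕃._≈_

infixr 8 _^ˢ_ _^_
_^ˢ_ : ℤ⟦q⟧ → ℕ → ℤ⟦q⟧
_^ˢ_ = 𝕊._^_

_^_ : ℤ⦅q⦆ → ℕ → ℤ⦅q⦆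
_^_ = 𝕃._^_

qˢ : ℤ⟦q⟧
qˢ = raise 1 1ˢ

raise-1ˢ-^ : ∀ n → raise n 1ˢ ≋ˢ qˢ ^ˢ n
raise-1ˢ-^ zero    = 𝕊.refl
raise-1ˢ-^ (suc n) = begin
  raise (suc n) 1ˢ            ≈⟨ wrap (raise-raise 1 n 1ˢ) ⟩
  raise 1 (raise n 1ˢ)        ≈⟨ wrap (raise-1ˢ 1 (raise n 1ˢ)) ⟨
  qˢ *ˢ raise n 1ˢ            ≈⟨ 𝕊.*-congˡ {qˢ} (raise-1ˢ-^ n) ⟩
  qˢ *ˢ qˢ ^ˢ n               ∎
  where open 𝕊 using (begin_; step-≈-⟩; step-≈-⟨; _∎)

-- Reciprocals of power series

recipCoeffs-recip : ∀ a n (i : Fin (suc n)) → recipCoeffs a n i ≡ recip a (n ∸ toℕ i)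
recipCoeffs-recip a zero    Fin.zero    = refl
recipCoeffs-recip a (suc n) Fin.zero    = refl
recipCoeffs-recip a (suc n) (Fin.suc i) = recipCoeffs-recip a n i

recip-suc : ∀ a n → recip a (suc n) ≡ ℤ.- (tail a *ˢ recip a) n
recip-suc a n = cong ℤ.-_ (Σℤ.sum-cong-≋ {suc n} λ i → cong (a (suc (toℕ i)) ℤ.*_) (recipCoeffs-recip a n i))

recip-inverse : ∀ a → a 0 ≡ 1ℤ → a *ˢ recip a ≋ˢ 1ˢ
recip-inverse a a₀≡1 = wrap go
  where
  cancel : ∀ z → 1ℤ ℤ.* ℤ.- z ℤ.+ z ≡ 0ℤ
  cancel z = ≡.trans (cong (ℤ._+ z) (ℤ.*-identityˡ (ℤ.- z))) (ℤ.+-inverseˡ z)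
  go : a *ˢ recip a ≗ 1ˢ
  go zero    = cong (λ z → z ℤ.* 1ℤ ℤ.+ 0ℤ) a₀≡1
  go (suc n) = ≡.trans (cong₂ (λ x y → x ℤ.* y ℤ.+ (tail a *ˢ recip a) n) a₀≡1 (recip-suc a n)) (cancel ((tail a *ˢ recip a) n))

qPoch-const : ∀ n → qPoch n 0 ≡ 1ℤ
qPoch-const zero    = refl
qPoch-const (suc n) = cong (λ z → z ℤ.* 1ℤ ℤ.+ 0ℤ) (qPoch-const n)

h : ℕ → ℤ⟦q⟧
h n = recip (qPoch n)

h-zero : h 0 ≋ˢ 1ˢ
h-zero = 𝕊.trans (𝕊.sym (𝕊.*-identityˡ (h 0))) (recip-inverse (qPoch 0) refl)

-- Both sides are inverses of (q;q)ₙ, and inverses are unique.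
h-suc : ∀ n → (1ˢ -ˢ qˢ ^ˢ suc n) *ˢ h (suc n) ≋ˢ h n
h-suc n = 𝕊.trans (𝕊.*-congʳ {h (suc n)} (𝕊.+-congˡ {1ˢ} (𝕊.-‿cong (𝕊.sym (raise-1ˢ-^ (suc n))))))
  (𝕊.inverse-of-product {qPoch n} {h n} {1ˢ -ˢ raise (suc n) 1ˢ} {h (suc n)} (recip-inverse (qPoch n) (qPoch-const n)) (recip-inverse (qPoch (suc n)) (qPoch-const (suc n))))

ιᵂ-cong : ∀ {a b} → a ≋ˢ b → ι a ≋ ι b
ιᵂ-cong e = wrap (ι-cong (unwrap e))

ι-* : ∀ a b → ι (a *ˢ b) ≋ ι a * ι b
ι-* a b = 𝕃.refl

ι-^ : ∀ n → ι (qˢ ^ˢ n) ≋ q ^ n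
ι-^ zero    = 𝕃.refl
ι-^ (suc n) = 𝕃.*-congˡ {q} (ι-^ n)

ι-1-q^ : ∀ n → ι (1ˢ -ˢ qˢ ^ˢ n) ≋ 1# - q ^ n
ι-1-q^ n = 𝕃.+-congˡ {1#} {ι (-ˢ (qˢ ^ˢ n))} (𝕃.-‿cong (ι-^ n))

ι-∑ : ∀ n a → 𝕃.∑ n (ι ∘ a) ≋ ι (𝕊.∑ n a)
ι-∑ zero    a = 𝕃.refl
ι-∑ (suc n) a = 𝕃.+-congˡ {ι (a 0)} (ι-∑ n (a ∘ suc))

u : ℤ⦅q⦆
u = q^ -1ℤ

qu≋1 : q * u ≋ 1#
qu≋1 = 𝕃.trans (wrap (series-cong {1} {1} refl (unwrap (𝕊.*-identityʳ qˢ)))) (wrap (raise-pole 0 1 1ˢ))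

module Op = 𝕃.Operator q u qu≋1

open 𝕃 using (solve; _:=_; _:+_; _:*_; _:-_; :-_; 𝟙)

-- Evaluation of polynomials

eval-+ : ∀ p r x → eval (p +ᵖ r) x ≋ eval p x + eval r x
eval-+ []      r       x = 𝕃.sym (𝕃.+-identityˡ (eval r x))
eval-+ (a ∷ p) []      x = 𝕃.sym (𝕃.+-identityʳ (eval (a ∷ p) x))
eval-+ (a ∷ p) (b ∷ r) x = 𝕃.trans (𝕃.+-congˡ {a + b} (𝕃.*-congˡ {x} (eval-+ p r x)))
  (solve 5 (λ a b x p r → a :+ b :+ x :* (p :+ r) := a :+ x :* p :+ (b :+ x :* r)) 𝕃.refl a b x (eval p x) (eval r x))

eval-· : ∀ c p x → eval (c ·ᵖ p) x ≋ c * eval p x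
eval-· c []      x = 𝕃.sym (𝕃.zeroʳ c)
eval-· c (a ∷ p) x = 𝕃.trans (𝕃.+-congˡ {c * a} (𝕃.*-congˡ {x} (eval-· c p x)))
  (solve 4 (λ c a x p → c :* a :+ x :* (c :* p) := c :* (a :+ x :* p)) 𝕃.refl c a x (eval p x))

eval-neg : ∀ p x → eval (map -_ p) x ≋ - eval p x
eval-neg []      x = 𝕃.refl
eval-neg (a ∷ p) x = 𝕃.trans (𝕃.+-congˡ { - a} (𝕃.*-congˡ {x} (eval-neg p x)))
  (solve 3 (λ a x p → :- a :+ x :* :- p := :- (a :+ x :* p)) 𝕃.refl a x (eval p x))

eval-dilate : ∀ c p x → eval (dilate c p) x ≋ eval p (c * x)
eval-dilate c []      x = 𝕃.refl
eval-dilate c (a ∷ p) x = 𝕃.+-congˡ {a} (𝕃.trans (𝕃.*-congˡ {x} (𝕃.trans (eval-· c (dilate c p) x) (𝕃.*-congˡ {c} (eval-dilate c p x))))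
  (solve 3 (λ c x p → x :* (c :* p) := c :* x :* p) 𝕃.refl c x (eval p (c * x))))

x*eval-divX : ∀ p x → x * eval (divX (p -ᵖ dilate q p)) x ≋ eval p x - eval p (q * x)
x*eval-divX p x = 𝕃.trans (no-constant-term p) (𝕃.trans (eval-+ p (map -_ (dilate q p)) x)
  (𝕃.+-congˡ {eval p x} (𝕃.trans (eval-neg (dilate q p) x) (𝕃.-‿cong (eval-dilate q p x)))))
  where
  no-constant-term : ∀ p → x * eval (divX (p -ᵖ dilate q p)) x ≋ eval (p -ᵖ dilate q p) x
  no-constant-term []      = 𝕃.zeroʳ x
  no-constant-term (a ∷ p) = 𝕃.sym (𝕃.trans (𝕃.+-congʳ (𝕃.-‿inverseʳ a)) (𝕃.+-identityˡ (x * eval (divX ((a ∷ p) -ᵖ dilate q (a ∷ p))) x)))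

operator : Poly → Poly
operator p = mulX p +ᵖ (((q - 1#) * (- u)) ·ᵖ D p)

-- For s = -u, (q - 1) s D p = u (p(x) - p(qx)) / x, and 1/x = uⁱ at x = qⁱ. The solver leaves
-- multiples of x y - 1 and of r (1 - q) - 1, where `r` is the factor 1/(1 - q) in `D`.
eval-operator : ∀ p i → eval (operator p) (q ^ i) ≋ Op.T (λ i → eval p (q ^ i)) i
eval-operator p i = begin
  eval (operator p) x
    ≈⟨ 𝕃.trans (eval-+ (mulX p) (c ·ᵖ D p) x) (𝕃.+-congˡ {eval (mulX p) x} (𝕃.trans (eval-· c (D p) x) (𝕃.*-congˡ {c} (eval-· r (divX (p -ᵖ dilate q p)) x)))) ⟩
  0# + x * eval p x + (q - 1#) * (- u) * (r * E)
    ≈⟨ solve 8 (λ z a q u r E x y → z :+ a :+ (q :- 𝟙) :* (:- u) :* (r :* E)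
         := z :+ (a :+ u :* y :* (x :* E)) :+ (x :* y :- 𝟙) :* (:- u :* E) :+ (r :* (𝟙 :- q) :- 𝟙) :* (u :* E))
         𝕃.refl 0# (x * eval p x) q u r E x y ⟩
  0# + (x * eval p x + u * y * (x * E)) + (x * y - 1#) * (- u * E) + (r * (1# - q) - 1#) * (u * E)
    ≈⟨ 𝕃.trans (𝕃.+-0*ʳ (0# + a + (x * y - 1#) * (- u * E)) (u * E) r*[1-q]≋1) (𝕃.trans (𝕃.+-0*ʳ (0# + a) (- u * E) (Op.q^i*u^i≈1 i)) (𝕃.+-identityˡ a)) ⟩
  x * eval p x + u * y * (x * E)
    ≈⟨ 𝕃.+-congˡ {x * eval p x} (𝕃.*-congˡ {u * y} (x*eval-divX p x)) ⟩
  x * eval p x + u * y * (eval p x - eval p (q * x)) ∎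
  where
  open 𝕃 using (begin_; step-≈-⟩; step-≈-⟨; _∎)
  x = q ^ i
  y = u ^ i
  r = ι (recip (1ˢ -ˢ raise 1 1ˢ))
  E = eval (divX (p -ᵖ dilate q p)) x
  c = (q - 1#) * (- u)
  a = x * eval p x + u * y * (x * E)
  r*[1-q]≋1 : r * (1# - q) ≋ 1#
  r*[1-q]≋1 = 𝕃.trans (𝕃.*-comm r (1# - q)) (ιᵂ-cong {(1ˢ -ˢ raise 1 1ˢ) *ˢ recip (1ˢ -ˢ raise 1 1ˢ)} (recip-inverse (1ˢ -ˢ raise 1 1ˢ) refl))

-- The values f n, defined by the recurrence of `Φ-+3` and not through u, so that they are power
-- series and congruences apply.
fˢ : ℕ → ℤ⟦q⟧
fˢ 0                   = 1ˢ
fˢ 1                   = 1ˢ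
fˢ 2                   = 0ˢ
fˢ (suc (suc (suc n))) = -ˢ (qˢ ^ˢ suc n *ˢ fˢ n)

ι-fˢ : ∀ n → ι (fˢ n) ≋ Op.Φ (suc n) 0
ι-fˢ 0 = 𝕃.refl
ι-fˢ 1 = 𝕃.sym (𝕃.trans (𝕃.+-congˡ (𝕃.-‿cong (𝕃.zeroʳ (q ^ 0 * u ^ 1)))) (wrap (ι-cong (unwrap (𝕊.+-identityʳ 1ˢ)))))
ι-fˢ 2 = 𝕃.sym (𝕃.trans (Op.Φ-+3 0) (𝕃.-‿cong (𝕃.zeroʳ 1#)))
ι-fˢ (suc (suc (suc n))) = 𝕃.sym (𝕃.trans (Op.Φ-+3 (suc n)) (𝕃.-‿cong (𝕃.*-cong (𝕃.sym (ι-^ (suc n))) (𝕃.sym (ι-fˢ n)))))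

1^n : ∀ n → 1# ^ n ≋ 1#
1^n zero    = 𝕃.refl
1^n (suc n) = 𝕃.trans (𝕃.*-identityˡ (1# ^ n)) (1^n n)

U-at-1 : ∀ n → Op.U n 0 ≋ ι (fˢ n)
U-at-1 n = 𝕃.trans (𝕃.*-cong (1^n n) (𝕃.sym (ι-fˢ n))) (𝕃.*-identityˡ (ι (fˢ n)))

hᴸ-suc : ∀ n → (1# - q ^ suc n) * ι (h (suc n)) ≋ ι (h n)
hᴸ-suc n = 𝕃.trans (𝕃.*-congʳ (𝕃.sym (ι-1-q^ (suc n)))) (𝕃.trans (𝕃.sym (ι-* (1ˢ -ˢ qˢ ^ˢ suc n) (h (suc n)))) (ιᵂ-cong (h-suc n)))

module QExpansion = Op.Expansion (ι ∘ h) (ιᵂ-cong h-zero) hᴸ-suc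
module Hˢ = 𝕊.ReciprocalFactorials qˢ h h-zero h-suc
module Hᴸ = 𝕃.ReciprocalFactorials q (ι ∘ h) (ιᵂ-cong h-zero) hᴸ-suc

ι-h⁻ : ∀ n k → ι (Hˢ.h⁻ n k) ≡ Hᴸ.h⁻ n k
ι-h⁻ n       zero    = refl
ι-h⁻ zero    (suc k) = refl
ι-h⁻ (suc n) (suc k) = ι-h⁻ n k

-- The inversion at x = 1 holds for Laurent series; both sides being power series, injectivity of
-- `ι` brings it down.
h-expansion : ∀ {M} n → n ℕ.< M →
  𝕊.∑ M (λ k → Hˢ.h⁻ n k *ˢ h (suc (n ℕ.+ k)) *ˢ (1ˢ -ˢ qˢ ^ˢ suc (k ℕ.* 2)) *ˢ fˢ (k ℕ.* 2)) ≋ˢ h (n ℕ.* 2)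
h-expansion {M} n n<M = wrap (ι-injective (unwrap (begin
  ι (𝕊.∑ M t)
    ≈⟨ ι-∑ M t ⟨
  𝕃.∑ M (ι ∘ t)
    ≈⟨ 𝕃.∑-cong M {ι ∘ t} ι-t ⟩
  QExpansion.evenSum M n 0
    ≈⟨ QExpansion.even-expansion n n<M 0 ⟩
  ι (h (n ℕ.* 2)) * 1# ^ (n ℕ.* 2)
    ≈⟨ 𝕃.*-congˡ {ι (h (n ℕ.* 2))} (1^n (n ℕ.* 2)) ⟩
  ι (h (n ℕ.* 2)) * 1#
    ≈⟨ 𝕃.*-identityʳ (ι (h (n ℕ.* 2))) ⟩
  ι (h (n ℕ.* 2)) ∎)))
  where
  open 𝕃 using (begin_; step-≈-⟩; step-≈-⟨; _∎)
  t : ℕ → ℤ⟦q⟧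
  t k = Hˢ.h⁻ n k *ˢ h (suc (n ℕ.+ k)) *ˢ (1ˢ -ˢ qˢ ^ˢ suc (k ℕ.* 2)) *ˢ fˢ (k ℕ.* 2)
  ι-t : ∀ k → ι (t k) ≋ QExpansion.evenCoeff n k * Op.U (k ℕ.* 2) 0
  ι-t k = 𝕃.trans (ι-* (H *ˢ h (suc (n ℕ.+ k)) *ˢ g) (fˢ (k ℕ.* 2))) (𝕃.*-cong
    (𝕃.trans (ι-* (H *ˢ h (suc (n ℕ.+ k))) g) (𝕃.*-cong
      (𝕃.trans (ι-* H (h (suc (n ℕ.+ k)))) (𝕃.*-congʳ (𝕃.reflexive (ι-h⁻ n k))))
      (ι-1-q^ (suc (k ℕ.* 2)))))
    (𝕃.sym (U-at-1 (k ℕ.* 2))))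
    where
    H = Hˢ.h⁻ n k
    g = 1ˢ -ˢ qˢ ^ˢ suc (k ℕ.* 2)

-- Congruence modulo qⁿ

infix 4 _≡[_]_
record _≡[_]_ (a : ℤ⟦q⟧) (n : ℕ) (b : ℤ⟦q⟧) : Set where
  constructor agree
  field below : ∀ i → i ℕ.< n → a i ≡ b i
open _≡[_]_ using (below)

modulo : ℕ → Setoid 0ℓ 0ℓ
modulo n = record
  { Carrier = ℤ⟦q⟧
  ; _≈_ = _≡[ n ]_
  ; isEquivalence = record
    { refl  = agree λ _ _ → refl
    ; sym   = λ d → agree λ i i<n → ≡.sym (below d i i<n)
    ; trans = λ d e → agree λ i i<n → ≡.trans (below d i i<n) (below e i i<n)
    }
  }

≋⇒≡[] : ∀ {n a b} → a ≋ˢ b → a ≡[ n ] b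
≋⇒≡[] e = agree λ i _ → unwrap e i

≡[]-weaken : ∀ {m n a b} → m ℕ.≤ n → a ≡[ n ] b → a ≡[ m ] b
≡[]-weaken m≤n e = agree λ i i<m → below e i (ℕ.≤-trans i<m m≤n)

≡[]-+ : ∀ {n a a′ b b′} → a ≡[ n ] a′ → b ≡[ n ] b′ → a +ˢ b ≡[ n ] a′ +ˢ b′
≡[]-+ d e = agree λ i i<n → cong₂ ℤ._+_ (below d i i<n) (below e i i<n)

≡[]-* : ∀ {n a a′ b b′} → a ≡[ n ] a′ → b ≡[ n ] b′ → a *ˢ b ≡[ n ] a′ *ˢ b′
≡[]-* d e = agree λ i i<n → Σℤ.sum-cong-≋ {suc i} λ j → cong₂ ℤ._*_
  (below d (toℕ j) (ℕ.≤-trans (Fin.toℕ<n j) i<n))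
  (below e (i ∸ toℕ j) (ℕ.≤-trans (s≤s (ℕ.m∸n≤m i (toℕ j))) i<n))

≡[]-*ˡ : ∀ {n} a {b b′} → b ≡[ n ] b′ → a *ˢ b ≡[ n ] a *ˢ b′
≡[]-*ˡ a e = ≡[]-* {a = a} (agree λ _ _ → refl) e

≡[]-*ʳ : ∀ {n a a′} b → a ≡[ n ] a′ → a *ˢ b ≡[ n ] a′ *ˢ b
≡[]-*ʳ b e = ≡[]-* {b = b} e (agree λ _ _ → refl)

≡[]-∑ : ∀ {n} N {f g : ℕ → ℤ⟦q⟧} → (∀ k → f k ≡[ n ] g k) → 𝕊.∑ N f ≡[ n ] 𝕊.∑ N g
≡[]-∑ zero    e = agree λ _ _ → refl
≡[]-∑ (suc N) e = ≡[]-+ (e 0) (≡[]-∑ N (e ∘ suc))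

raise-≡[] : ∀ m {n a b} → a ≡[ n ] b → raise m a ≡[ m ℕ.+ n ] raise m b
raise-≡[] zero    e = agree (below e)
raise-≡[] (suc m) e = agree λ { zero _ → refl ; (suc i) (s≤s i<) → below (raise-≡[] m e) i i< }

q^*-raise : ∀ m a → qˢ ^ˢ m *ˢ a ≋ˢ raise m a
q^*-raise m a = 𝕊.trans (𝕊.*-congʳ {a} (𝕊.sym (raise-1ˢ-^ m))) (wrap (raise-1ˢ m a))

q^*-≡[] : ∀ m {n a b} → a ≡[ n ] b → qˢ ^ˢ m *ˢ a ≡[ m ℕ.+ n ] qˢ ^ˢ m *ˢ b
q^*-≡[] m {n} {a} {b} e = begin
  qˢ ^ˢ m *ˢ a     ≈⟨ ≋⇒≡[] (q^*-raise m a) ⟩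
  raise m a        ≈⟨ raise-≡[] m e ⟩
  raise m b        ≈⟨ ≋⇒≡[] (q^*-raise m b) ⟨
  qˢ ^ˢ m *ˢ b     ∎
  where open SetoidReasoning (modulo (m ℕ.+ n))

q^*-≡[]-0 : ∀ {m n} a → n ℕ.≤ m → qˢ ^ˢ m *ˢ a ≡[ n ] 0ˢ
q^*-≡[]-0 {m} {n} a n≤m = begin
  qˢ ^ˢ m *ˢ a     ≈⟨ ≡[]-weaken (ℕ.≤-trans n≤m (ℕ.≤-reflexive (≡.sym (ℕ.+-identityʳ m)))) (q^*-≡[] m {0} {a} {0ˢ} (agree λ _ ())) ⟩
  qˢ ^ˢ m *ˢ 0ˢ    ≈⟨ ≋⇒≡[] (𝕊.zeroʳ (qˢ ^ˢ m)) ⟩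
  0ˢ               ∎
  where open SetoidReasoning (modulo n)

*-≡[]-0 : ∀ {n} a {b} → b ≡[ n ] 0ˢ → a *ˢ b ≡[ n ] 0ˢ
*-≡[]-0 {n} a {b} e = begin
  a *ˢ b      ≈⟨ ≡[]-*ˡ a e ⟩
  a *ˢ 0ˢ     ≈⟨ ≋⇒≡[] (𝕊.zeroʳ a) ⟩
  0ˢ          ∎
  where open SetoidReasoning (modulo n)

+-≡[]-0 : ∀ {n} a {b} → b ≡[ n ] 0ˢ → a +ˢ b ≡[ n ] a
+-≡[]-0 {n} a {b} e = begin
  a +ˢ b      ≈⟨ ≡[]-+ {n} {a} (agree λ _ _ → refl) e ⟩
  a +ˢ 0ˢ     ≈⟨ ≋⇒≡[] (𝕊.+-identityʳ a) ⟩
  a           ∎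
  where open SetoidReasoning (modulo n)

∑-≡[]-0 : ∀ {n} N {f : ℕ → ℤ⟦q⟧} → (∀ k → f k ≡[ n ] 0ˢ) → 𝕊.∑ N f ≡[ n ] 0ˢ
∑-≡[]-0 {n} N {f} e = begin
  𝕊.∑ N f               ≈⟨ ≡[]-∑ N e ⟩
  𝕊.∑ N (λ _ → 0ˢ)      ≈⟨ ≋⇒≡[] (𝕊.∑-zero N) ⟩
  0ˢ                    ∎
  where open SetoidReasoning (modulo n)

-- If term k is divisible by qᵏ, the coefficient of qⁱ in the infinite sum is settled by the terms 0
-- to i, where `∑∞` reads it off.
Summable : (ℕ → ℤ⟦q⟧) → Set
Summable f = ∀ k → f k ≡[ k ] 0ˢ

∑∞ : (ℕ → ℤ⟦q⟧) → ℤ⟦q⟧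
∑∞ f i = 𝕊.∑ (suc i) f i

∑-stable : ∀ {f} → Summable f → ∀ {m n} → m ℕ.≤ n → 𝕊.∑ n f ≡[ m ] 𝕊.∑ m f
∑-stable {f} s {m} {n} m≤n = begin
  𝕊.∑ n f                                           ≡⟨ cong (λ n → 𝕊.∑ n f) (ℕ.m+[n∸m]≡n m≤n) ⟨
  𝕊.∑ (m ℕ.+ (n ∸ m)) f                             ≈⟨ ≋⇒≡[] (𝕊.∑-split m (n ∸ m) f) ⟩
  𝕊.∑ m f +ˢ 𝕊.∑ (n ∸ m) (λ k → f (m ℕ.+ k))        ≈⟨ +-≡[]-0 (𝕊.∑ m f) (∑-≡[]-0 (n ∸ m) {λ k → f (m ℕ.+ k)} λ k → ≡[]-weaken (ℕ.m≤m+n m k) (s (m ℕ.+ k))) ⟩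
  𝕊.∑ m f                                           ∎
  where open SetoidReasoning (modulo m)

∑-≡[]-∑∞ : ∀ {f} → Summable f → ∀ n → 𝕊.∑ n f ≡[ n ] ∑∞ f
∑-≡[]-∑∞ s n = agree λ i i<n → below (∑-stable s i<n) i (ℕ.n<1+n i)

-- The coefficient of qⁱ in (q;q)ₙ is stable from n = i on, so the infinite product is the diagonal.
qPoch∞ : ℤ⟦q⟧
qPoch∞ i = qPoch i i

qPoch-suc : ∀ n → qPoch (suc n) ≡[ suc n ] qPoch n
qPoch-suc n = begin
  qPoch n *ˢ (1ˢ -ˢ raise (suc n) 1ˢ)
    ≈⟨ ≡[]-*ˡ (qPoch n) (+-≡[]-0 1ˢ { -ˢ raise (suc n) 1ˢ} (agree λ i i<n → cong ℤ.-_ (below (raise-0 (suc n)) i i<n))) ⟩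
  qPoch n *ˢ 1ˢ
    ≈⟨ ≋⇒≡[] (𝕊.*-identityʳ (qPoch n)) ⟩
  qPoch n ∎
  where
  open SetoidReasoning (modulo (suc n))
  raise-0 : ∀ m → raise m 1ˢ ≡[ m ] 0ˢ
  raise-0 zero    = agree λ _ ()
  raise-0 (suc m) = agree λ { zero _ → refl ; (suc i) (s≤s i<m) → below (raise-0 m) i i<m }

qPoch-≡[]-qPoch∞ : ∀ n → qPoch n ≡[ suc n ] qPoch∞
qPoch-≡[]-qPoch∞ n = agree λ i i<1+n → stable n i (ℕ.≤-pred i<1+n)
  where
  stable : ∀ n i → i ℕ.≤ n → qPoch n i ≡ qPoch i i
  stable n i i≤n with ℕ.m≤n⇒m<n∨m≡n i≤n
  ... | inj₂ refl = refl
  stable (suc n) i _ | inj₁ i<1+n = ≡.trans (below (qPoch-suc n) i i<1+n) (stable n i (ℕ.≤-pred i<1+n))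

h-≡[] : ∀ n → h n ≡[ suc n ] recip qPoch∞
h-≡[] n = begin
  h n                                   ≈⟨ ≋⇒≡[] (𝕊.cancel-inverse {qPoch∞} {recip qPoch∞} (h n) (recip-inverse qPoch∞ refl)) ⟨
  qPoch∞ *ˢ h n *ˢ recip qPoch∞         ≈⟨ ≡[]-*ʳ (recip qPoch∞) (≡[]-*ʳ (h n) (qPoch-≡[]-qPoch∞ n)) ⟨
  qPoch n *ˢ h n *ˢ recip qPoch∞        ≈⟨ ≋⇒≡[] (𝕊.*-congʳ {recip qPoch∞} (recip-inverse (qPoch n) (qPoch-const n))) ⟩
  1ˢ *ˢ recip qPoch∞                    ≈⟨ ≋⇒≡[] (𝕊.*-identityˡ (recip qPoch∞)) ⟩
  recip qPoch∞                          ∎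
  where open SetoidReasoning (modulo (suc n))

open Hˢ using (durfeeTerm; durfee-step)

-- Durfee's identity in the limit

durfeeTerm-≡[]-0 : ∀ m j → durfeeTerm m j ≡[ j ] 0ˢ
durfeeTerm-≡[]-0 m zero    = agree λ _ ()
durfeeTerm-≡[]-0 m (suc j) = q^*-≡[]-0 (h (suc j) *ˢ h (suc j ℕ.+ m)) (ℕ.≤-trans (ℕ.m≤m*n (suc j) (suc j)) (ℕ.m≤m+n _ _))

durfee-suc : ∀ m J → 𝕊.∑ J (durfeeTerm m) ≡[ J ] 𝕊.∑ J (durfeeTerm (suc m))
durfee-suc m J = begin
  𝕊.∑ J (durfeeTerm m)
    ≈⟨ +-≡[]-0 (𝕊.∑ J (durfeeTerm m)) (*-≡[]-0 (1ˢ -ˢ qˢ ^ˢ J) (durfeeTerm-≡[]-0 m J)) ⟨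
  𝕊.∑ J (durfeeTerm m) +ˢ (1ˢ -ˢ qˢ ^ˢ J) *ˢ durfeeTerm m J
    ≈⟨ ≋⇒≡[] (durfee-step m J) ⟩
  𝕊.∑ J (durfeeTerm (suc m)) ∎
  where open SetoidReasoning (modulo J)

durfee-+ : ∀ n m J → 𝕊.∑ J (durfeeTerm m) ≡[ J ] 𝕊.∑ J (durfeeTerm (n ℕ.+ m))
durfee-+ zero    m J = agree λ _ _ → refl
durfee-+ (suc n) m J = Setoid.trans (modulo J) (durfee-+ n m J) (durfee-suc (n ℕ.+ m) J)

-- Every term with j > 0 contains the factor qᵐ.
durfee-≡[]-h : ∀ m J → 𝕊.∑ (suc J) (durfeeTerm m) ≡[ m ] h m
durfee-≡[]-h m J = begin
  1ˢ *ˢ (h 0 *ˢ h m) +ˢ 𝕊.∑ J (durfeeTerm m ∘ suc)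
    ≈⟨ +-≡[]-0 (1ˢ *ˢ (h 0 *ˢ h m)) (∑-≡[]-0 J {durfeeTerm m ∘ suc} λ j → q^*-≡[]-0 (h (suc j) *ˢ h (suc j ℕ.+ m)) (ℕ.≤-trans (ℕ.m≤m+n m (j ℕ.* m)) (ℕ.m≤n+m _ (suc j ℕ.* suc j)))) ⟩
  1ˢ *ˢ (h 0 *ˢ h m)
    ≈⟨ ≋⇒≡[] (𝕊.trans (𝕊.*-identityˡ (h 0 *ˢ h m)) (𝕊.trans (𝕊.*-congʳ {h m} h-zero) (𝕊.*-identityˡ (h m)))) ⟩
  h m ∎
  where open SetoidReasoning (modulo m)

-- Modulo q^J the sum does not depend on `m`, so `m` may be enlarged by `J`. Then only the term j =
-- 0 survives, and its h is already congruent to 1/(q;q)_∞.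
durfee-limit : ∀ m J → 𝕊.∑ J (durfeeTerm m) ≡[ J ] recip qPoch∞
durfee-limit m zero    = agree λ _ ()
durfee-limit m (suc J) = begin
  𝕊.∑ (suc J) (durfeeTerm m)       ≈⟨ durfee-+ (suc J) m (suc J) ⟩
  𝕊.∑ (suc J) (durfeeTerm n)       ≈⟨ ≡[]-weaken (ℕ.m≤m+n (suc J) m) (durfee-≡[]-h n J) ⟩
  h n                              ≈⟨ ≡[]-weaken (ℕ.≤-trans (ℕ.m≤m+n (suc J) m) (ℕ.n≤1+n n)) (h-≡[] n) ⟩
  recip qPoch∞                     ∎
  where
  open SetoidReasoning (modulo (suc J))
  n = suc J ℕ.+ m

open 𝕊.Telescoping qˢ fˢ 𝕊.refl using (telescopingTerm; lucasTerm; ∑-lucasTerm; module ThetaTerms)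
open ThetaTerms 𝕊.refl 𝕊.refl (λ _ → 𝕊.refl)
open 𝕊.Interchange qˢ h h-zero h-suc fˢ 𝕊.refl using (interchange)

bailey : ℕ → ℤ⟦q⟧
bailey n = qˢ ^ˢ (n ℕ.* n ℕ.+ n) *ˢ h (n ℕ.* 2)

bailey-summable : Summable bailey
bailey-summable n = q^*-≡[]-0 (h (n ℕ.* 2)) (ℕ.m≤n+m n (n ℕ.* n))

telescopingTerm-summable : Summable telescopingTerm
telescopingTerm-summable n = q^*-≡[]-0 ((1ˢ -ˢ qˢ ^ˢ suc (n ℕ.* 2)) *ˢ fˢ (n ℕ.* 2)) (ℕ.m≤n+m n (n ℕ.* n))

-- The truncated Durfee sum is correct only modulo q^(N ∸ k); the factor q^(k² + k) makes up for the
-- missing k.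
telescopingTerm*durfee : ∀ N k → telescopingTerm k *ˢ 𝕊.∑ (N ∸ k) (durfeeTerm (suc (k ℕ.* 2))) ≡[ N ] recip qPoch∞ *ˢ telescopingTerm k
telescopingTerm*durfee N k = begin
  a *ˢ g *ˢ s                ≈⟨ ≋⇒≡[] (𝕊.*-assoc a g s) ⟩
  a *ˢ (g *ˢ s)              ≈⟨ ≡[]-weaken N≤ (q^*-≡[] (k ℕ.* k ℕ.+ k) (≡[]-*ˡ g (durfee-limit (suc (k ℕ.* 2)) (N ∸ k)))) ⟩
  a *ˢ (g *ˢ r)              ≈⟨ ≋⇒≡[] (𝕊.*-assoc a g r) ⟨
  a *ˢ g *ˢ r                ≈⟨ ≋⇒≡[] (𝕊.*-comm (a *ˢ g) r) ⟩
  r *ˢ (a *ˢ g)              ∎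
  where
  open SetoidReasoning (modulo N)
  a = qˢ ^ˢ (k ℕ.* k ℕ.+ k)
  g = (1ˢ -ˢ qˢ ^ˢ suc (k ℕ.* 2)) *ˢ fˢ (k ℕ.* 2)
  r = recip qPoch∞
  s = 𝕊.∑ (N ∸ k) (durfeeTerm (suc (k ℕ.* 2)))
  N≤ : N ℕ.≤ k ℕ.* k ℕ.+ k ℕ.+ (N ∸ k)
  N≤ = ℕ.≤-trans (ℕ.m≤n+m∸n N k) (ℕ.+-monoˡ-≤ (N ∸ k) (ℕ.m≤n+m k (k ℕ.* k)))

∑∞-bailey : ∑∞ bailey ≗ recip qPoch∞ *ˢ ∑∞ telescopingTerm
∑∞-bailey i = below (begin
  ∑∞ bailey
    ≈⟨ ∑-≡[]-∑∞ bailey-summable N ⟨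
  𝕊.∑ N bailey
    ≈⟨ ≋⇒≡[] (interchange h-expansion N) ⟩
  𝕊.∑ N (λ k → telescopingTerm k *ˢ 𝕊.∑ (N ∸ k) (durfeeTerm (suc (k ℕ.* 2))))
    ≈⟨ ≡[]-∑ N (telescopingTerm*durfee N) ⟩
  𝕊.∑ N (λ k → recip qPoch∞ *ˢ telescopingTerm k)
    ≈⟨ ≋⇒≡[] (𝕊.∑-*ˡ N (recip qPoch∞) telescopingTerm) ⟨
  recip qPoch∞ *ˢ 𝕊.∑ N telescopingTerm
    ≈⟨ ≡[]-*ˡ (recip qPoch∞) (∑-≡[]-∑∞ telescopingTerm-summable N) ⟩
  recip qPoch∞ *ˢ ∑∞ telescopingTerm ∎) i (ℕ.n<1+n i)
  where
  N = suc i
  open SetoidReasoning (modulo N)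

-- From congruences to limits of Laurent series

coeff-agree : ∀ {f a b N} → f ≋ ι a → a ≡[ suc ℤ.∣ N ∣ ] b → ∀ z → z ℤ.≤ N → coeff f z ≡ coeff (ι b) z
coeff-agree {f} {a} {b} {N} f≋a e z z≤N = begin
  coeff f z         ≡⟨ unwrap f≋a z ⟩
  coeff (ι a) z     ≡⟨ coeff-at 0 a z ⟩
  a at (z ℤ.+ 0ℤ)   ≡⟨ cong (a at_) (ℤ.+-identityʳ z) ⟩
  a at z            ≡⟨ at-agree z z≤N ⟩
  b at z            ≡⟨ cong (b at_) (ℤ.+-identityʳ z) ⟨
  b at (z ℤ.+ 0ℤ)   ≡⟨ coeff-at 0 b z ⟨
  coeff (ι b) z     ∎
  where
  open ≡-Reasoning
  at-agree : ∀ z → z ℤ.≤ N → a at z ≡ b at z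
  at-agree (+ i)    (ℤ.+≤+ i≤n) = below e i (s≤s i≤n)
  at-agree -[1+ i ] _           = refl

-- Precision n is asked only of approximation n + 1, because `∑-lucasTerm` matches n + 1 Lucas terms
-- with n terms b k. Agreement up to exponent N takes precision |N| + 1, hence the witness 2 + |N|.
⟶-intro : ∀ {f : ℕ → ℤ⦅q⦆} {a : ℕ → ℤ⟦q⟧} {l} → (∀ n → f n ≋ ι (a n)) → (∀ n → a (suc n) ≡[ n ] l) → f ⟶ ι l
⟶-intro {f} {a} {l} f≋a e N = 2 ℕ.+ ℤ.∣ N ∣ , λ { (suc m) (s≤s N<m) → coeff-agree (f≋a (suc m)) (≡[]-weaken N<m (e m)) }

∑ℕ-intro : ∀ (f : ℕ → ℤ⦅q⦆) {a : ℕ → ℤ⟦q⟧} {l} → (∀ n → f n ≋ ι (a n)) → (∀ n → 𝕊.∑ (suc n) a ≡[ n ] l) → ∑ℕ f ≔ ι l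
∑ℕ-intro f {a} f≋a = ⟶-intro (λ n → 𝕃.trans (𝕃.∑-cong n {f} f≋a) (ι-∑ n a))

∑ℤ-intro : ∀ (f : ℤ → ℤ⦅q⦆) {a b : ℕ → ℤ⟦q⟧} {l} → (∀ n → f -[1+ n ] ≋ ι (a n)) → (∀ n → f (+ n) ≋ ι (b n)) →
  (∀ {N m n} → N ℕ.≤ m → N ℕ.≤ n → 𝕊.∑ m a +ˢ 𝕊.∑ n b ≡[ N ] l) → ∑ℤ f ≔ ι l
∑ℤ-intro f {a} {b} f≋a f≋b e N = suc ℤ.∣ N ∣ , λ m n N≤m N≤n → coeff-agree {a = 𝕊.∑ m a +ˢ 𝕊.∑ n b}
  (𝕃.trans (𝕃.+-cong (𝕃.trans (𝕃.∑-cong m {f ∘ -[1+_]} f≋a) (ι-∑ m a)) (𝕃.trans (𝕃.∑-cong n {f ∘ +_} f≋b) (ι-∑ n b)))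
    (𝕃.refl {ι (𝕊.∑ m a +ˢ 𝕊.∑ n b)}))
  (e N≤m N≤n)

q^-+ : ∀ n → q^ (+ n) ≋ ι (qˢ ^ˢ n)
q^-+ n = ιᵂ-cong (raise-1ˢ-^ n)

∑-lucasTerm-≡[] : ∀ n → 𝕊.∑ (suc n) lucasTerm ≡[ n ] ∑∞ telescopingTerm
∑-lucasTerm-≡[] n = begin
  𝕊.∑ (suc n) lucasTerm
    ≈⟨ ≋⇒≡[] (∑-lucasTerm n) ⟩
  𝕊.∑ n telescopingTerm +ˢ qˢ ^ˢ (n ℕ.* n ℕ.+ n) *ˢ fˢ (n ℕ.* 2)
    ≈⟨ +-≡[]-0 (𝕊.∑ n telescopingTerm) (q^*-≡[]-0 (fˢ (n ℕ.* 2)) (ℕ.m≤n+m n (n ℕ.* n))) ⟩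
  𝕊.∑ n telescopingTerm
    ≈⟨ ∑-≡[]-∑∞ telescopingTerm-summable n ⟩
  ∑∞ telescopingTerm ∎
  where open SetoidReasoning (modulo n)

thetaTerm⁻ thetaTerm⁺ : ℕ → ℤ⟦q⟧
thetaTerm⁻ m = telescopingTerm (2 ℕ.+ m ℕ.* 3)
thetaTerm⁺ m = telescopingTerm (m ℕ.* 3)

theta-sum : ∀ {N m n} → N ℕ.≤ m → N ℕ.≤ n → 𝕊.∑ m thetaTerm⁻ +ˢ 𝕊.∑ n thetaTerm⁺ ≡[ N ] ∑∞ telescopingTerm
theta-sum {N} {m} {n} N≤m N≤n = begin
  𝕊.∑ m thetaTerm⁻ +ˢ 𝕊.∑ n thetaTerm⁺
    ≈⟨ ≡[]-+ (∑-stable summable⁻ N≤m) (∑-stable summable⁺ N≤n) ⟩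
  𝕊.∑ N thetaTerm⁻ +ˢ 𝕊.∑ N thetaTerm⁺
    ≈⟨ ≋⇒≡[] (∑-telescopingTerm N) ⟩
  𝕊.∑ (N ℕ.* 3) telescopingTerm
    ≈⟨ ≡[]-weaken (ℕ.m≤m*n N 3) (∑-≡[]-∑∞ telescopingTerm-summable (N ℕ.* 3)) ⟩
  ∑∞ telescopingTerm ∎
  where
  open SetoidReasoning (modulo N)
  summable⁺ : Summable thetaTerm⁺
  summable⁺ k = ≡[]-weaken (ℕ.m≤m*n k 3) (telescopingTerm-summable (k ℕ.* 3))
  summable⁻ : Summable thetaTerm⁻
  summable⁻ k = ≡[]-weaken (ℕ.≤-trans (ℕ.m≤m*n k 3) (ℕ.m≤n+m _ 2)) (telescopingTerm-summable (2 ℕ.+ k ℕ.* 3))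

eval-qLucas : ∀ n → eval (qLucas (2 ℕ.+ n) (- u)) 1# ≋ - u * ι (fˢ n) + ι (fˢ (2 ℕ.+ n))
eval-qLucas n = 𝕃.trans (Op.lucas-U v v₀ v₁ v₂ n 0) (𝕃.+-cong (𝕃.*-congˡ { - u} (U-at-1 n)) (U-at-1 (2 ℕ.+ n)))
  where
  v : ℕ → ℕ → ℤ⦅q⦆
  v n i = eval (qLucas n (- u)) (q ^ i)
  v₀ : ∀ i → v 0 i ≋ 1# + 1#
  v₀ i = 𝕃.trans (𝕃.+-congˡ {1# + 1#} (𝕃.zeroʳ (q ^ i))) (𝕃.+-identityʳ (1# + 1#))
  eval-1ᵖ : ∀ i → eval 1ᵖ (q ^ i) ≋ 1#
  eval-1ᵖ i = 𝕃.trans (𝕃.+-congˡ {1#} (𝕃.zeroʳ (q ^ i))) (𝕃.+-identityʳ 1#)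
  v₁ : ∀ i → v 1 i ≋ Op.T (λ _ → 1#) i
  v₁ i = 𝕃.trans (eval-operator 1ᵖ i) (Op.T-cong eval-1ᵖ i)
  -- `qLucas (2 + n)` computes to `operator p +ᵖ (- u ·ᵖ r)`, so its evaluation satisfies the
  -- recurrence required by `lucas-U`.
  v₂ : ∀ n i → v (2 ℕ.+ n) i ≋ Op.T (v (suc n)) i - u * v n i
  v₂ n i = 𝕃.trans (eval-+ (operator p) (- u ·ᵖ r) (q ^ i)) (𝕃.+-cong (eval-operator p i)
    (𝕃.trans (eval-· (- u) r (q ^ i)) (𝕃.solve 2 (λ u x → (𝕃.:- u) 𝕃.:* x 𝕃.:= 𝕃.:- (u 𝕃.:* x)) 𝕃.refl u (v n i))))
    where
    p = qLucas (suc n) (- u)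
    r = qLucas n (- u)

lucasSummand : ℕ → ℤ⦅q⦆
lucasSummand k = eval (qLucas* (2 ℕ.* k) (- u)) 1# * q^ (+ (k ℕ.* k ℕ.+ k))

lucas-term : ∀ k → lucasSummand k ≋ ι (lucasTerm k)
lucas-term zero    = 𝕃.trans (𝕃.*-identityʳ (1# + 1# * 0#)) (𝕃.trans (𝕃.+-congˡ {1#} (𝕃.zeroʳ 1#)) (𝕃.+-identityʳ 1#))
lucas-term (suc k) = begin
  eval (qLucas* (2 ℕ.* suc k) (- u)) 1# * q^ (+ e)
    ≈⟨ 𝕃.*-cong (𝕃.trans (𝕃.reflexive (cong (λ n → eval (qLucas* n (- u)) 1#) (ℕ.*-comm 2 (suc k)))) (eval-qLucas (k ℕ.* 2)))
         (𝕃.trans (q^-+ e) (ι-^ e)) ⟩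
  (- u * ι F + ι F₂) * q ^ e
    ≈⟨ 𝕃.solve 4 (λ u F F₂ x → (𝕃.:- u 𝕃.:* F 𝕃.:+ F₂) 𝕃.:* x 𝕃.:= x 𝕃.:* F₂ 𝕃.:- u 𝕃.:* x 𝕃.:* F) 𝕃.refl u (ι F) (ι F₂) (q ^ e) ⟩
  q ^ e * ι F₂ - u * q ^ e * ι F
    ≈⟨ 𝕃.+-congˡ {q ^ e * ι F₂} (𝕃.-‿cong (𝕃.*-congʳ {ι F} u*q^e)) ⟩
  q ^ e * ι F₂ - q ^ e′ * ι F
    ≈⟨ 𝕃.+-cong (𝕃.trans (ι-* (qˢ ^ˢ e) F₂) (𝕃.*-congʳ {ι F₂} (ι-^ e))) (𝕃.-‿cong (𝕃.trans (ι-* (qˢ ^ˢ e′) F) (𝕃.*-congʳ {ι F} (ι-^ e′)))) ⟨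
  ι (qˢ ^ˢ e *ˢ F₂) - ι (qˢ ^ˢ e′ *ˢ F)
    ≈⟨ 𝕃.refl {ι (lucasTerm (suc k))} ⟩
  ι (lucasTerm (suc k)) ∎
  where
  open 𝕃 using (begin_; step-≈-⟩; step-≈-⟨; _∎)
  e = suc k ℕ.* suc k ℕ.+ suc k
  e′ = k ℕ.* k ℕ.+ k ℕ.* 3 ℕ.+ 1
  F = fˢ (k ℕ.* 2)
  F₂ = fˢ (2 ℕ.+ k ℕ.* 2)
  exponent : e ≡ suc e′
  exponent = ℕ-Solver.solve 1 (λ k → (:con 1 ⊕ k) ⊗ (:con 1 ⊕ k) ⊕ (:con 1 ⊕ k) ≔ :con 1 ⊕ (k ⊗ k ⊕ k ⊗ :con 3 ⊕ :con 1)) refl k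
  u*q^e : u * q ^ e ≋ q ^ e′
  u*q^e = 𝕃.trans (𝕃.*-congˡ {u} (𝕃.^-congʳ q exponent)) (𝕃.trans (𝕃.sym (𝕃.*-assoc u q (q ^ e′)))
    (𝕃.trans (𝕃.*-congʳ {q ^ e′} (𝕃.trans (𝕃.*-comm u q) qu≋1)) (𝕃.*-identityˡ (q ^ e′))))

baileySummand : ℕ → ℤ⦅q⦆
baileySummand n = q^ (+ (n ℕ.* n ℕ.+ n)) * ι (recip (qPoch (2 ℕ.* n)))

bailey-term : ∀ n → baileySummand n ≋ ι (bailey n)
bailey-term n = begin
  q^ (+ e) * ι (h (2 ℕ.* n))         ≈⟨ 𝕃.*-cong (q^-+ e) (𝕃.reflexive (cong (ι ∘ h) (ℕ.*-comm 2 n))) ⟩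
  ι (qˢ ^ˢ e) * ι (h (n ℕ.* 2))      ≈⟨ ι-* (qˢ ^ˢ e) (h (n ℕ.* 2)) ⟨
  ι (bailey n)                       ∎
  where
  open 𝕃 using (begin_; step-≈-⟩; step-≈-⟨; _∎)
  e = n ℕ.* n ℕ.+ n

difference-term : ∀ {y z} m n → y ≡ + m → z ≡ + n → q^ y - q^ z ≋ ι ((qˢ ^ˢ m) -ˢ (qˢ ^ˢ n))
difference-term m n refl refl = 𝕃.+-cong {q^ (+ m)} {ι (qˢ ^ˢ m)} (q^-+ m) (𝕃.-‿cong (q^-+ n))

thetaSummand : ℤ → ℤ⦅q⦆
thetaSummand k = q^ (α k) - q^ (β k)

theta-term⁺ : ∀ m → thetaSummand (+ m) ≋ ι (thetaTerm⁺ m)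
theta-term⁺ m = 𝕃.trans
  (difference-term {α (+ m)} {β (+ m)} (15 ℕ.* m ℕ.* m ℕ.+ 2 ℕ.* m) (15 ℕ.* m ℕ.* m ℕ.+ 8 ℕ.* m ℕ.+ 1) (α-pos m) (≡.sym (pos-quadratic 15 8 1 m)))
  (ιᵂ-cong (𝕊.sym (telescopingTerm-3m m)))

theta-term⁻ : ∀ m → thetaSummand -[1+ m ] ≋ ι (thetaTerm⁻ m)
theta-term⁻ m = 𝕃.trans
  (difference-term {α -[1+ m ]} {β -[1+ m ]} (15 ℕ.* m ℕ.* m ℕ.+ 28 ℕ.* m ℕ.+ 13) (15 ℕ.* m ℕ.* m ℕ.+ 22 ℕ.* m ℕ.+ 8) (α-neg m) (β-neg m))
  (ιᵂ-cong (𝕊.sym (telescopingTerm-3m+2 m)))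

corollary5p3 : ∃[ P ] ∃[ A ] ∃[ B ] ∃[ C ]
    ((λ n → ι (qPoch n)) ⟶ ι P)
    × (∑ℕ (λ n → q^ (+ (n ℕ.* n ℕ.+ n)) * ι (recip (qPoch (2 ℕ.* n)))) ≔ ι A)
    × (∑ℕ (λ k → eval (qLucas* (2 ℕ.* k) (- (q^ -1ℤ))) 1# * q^ (+ (k ℕ.* k ℕ.+ k))) ≔ ι B)
    × (∑ℤ (λ k → q^ (+ 15 ℤ.* k ℤ.* k ℤ.+ + 2 ℤ.* k) - q^ (+ 15 ℤ.* k ℤ.* k ℤ.+ + 8 ℤ.* k ℤ.+ + 1)) ≔ ι C)
    × (A ≗ recip P *ˢ B)
    × (recip P *ˢ B ≗ recip P *ˢ C)
-- Both the Lucas sum and the theta sum converge to ∑ b k. The same series thus serves as `B` and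
-- `C`, and the last equation is trivial: its content lies in the two limit statements.
corollary5p3 = qPoch∞ , ∑∞ bailey , ∑∞ telescopingTerm , ∑∞ telescopingTerm
  , ⟶-intro (λ n → 𝕃.refl) (λ n → ≡[]-weaken (ℕ.m≤n+m n 2) (qPoch-≡[]-qPoch∞ (suc n)))
  , ∑ℕ-intro baileySummand bailey-term (λ n → ≡[]-weaken (ℕ.n≤1+n n) (∑-≡[]-∑∞ bailey-summable (suc n)))
  , ∑ℕ-intro lucasSummand lucas-term ∑-lucasTerm-≡[]
  , ∑ℤ-intro thetaSummand theta-term⁻ theta-term⁺ theta-sum
  , ∑∞-bailey
  , λ _ → refl
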